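{- If $P \subseteq \mathbb{R}^2$ is a nonempty open set, then $\operatorname{opx}(n, P) = \Theta(n^2)$ (as $n \to \infty$ over positive reals), where the constant in the lower bound depends on $P$.
   Context: Containment for subsets of the plane: for $P, S \subseteq \mathbb{R}^2$, let $X_P, Y_P$ be the sets of $x$-coordinates and $y$-coordinates of points of $P$, and $X_S, Y_S$ likewise for $S$. $S$ contains $P$ if there exist functions $f_X: X_P \to X_S$ and $f_Y: Y_P \to Y_S$ such that (1) $\frac{f_X(x_0)-f_X(x_1)}{x_0-x_1} \ge 1$ for all $x_0 > x_1$ in $X_P$; (2) $\frac{f_Y(y_0)-f_Y(y_1)}{y_0-y_1} \ge 1$ for all $y_0 > y_1$ in $Y_P$; (3) $(f_X(x), f_Y(y)) \in S$ for all $(x,y) \in P$. Otherwise $S$ is $P$-free. For real $n > 0$, $\operatorname{opx}(n,P)$ is the supremum of the Lebesgue measure $\mu_2(S)$ over all open (in $\mathbb{R}^2$) $P$-free subsets $S \subseteq [0,n]^2$. $f(n) = \Theta(g(n))$ means there are constants $C_1, C_2 > 0$ with $C_1 g(n) \le f(n) \le C_2 g(n)$ for all sufficiently large $n$. -}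

module Defs where

open import Level using (0ℓ; Lift; lift) renaming (suc to lsuc)
open import Data.Nat.Base using (ℕ; zero; suc)
open import Data.Fin.Base using (toℕ) renaming (zero to fzero; suc to fsuc)
open import Data.Product using (Σ; Σ-syntax; ∃; ∃-syntax; _×_; _,_; proj₁; proj₂)
open import Data.Sum using (inj₁; inj₂)
open import Data.Vec.Functional using (Vector; tail)
open import Algebra.Bundles using (CommutativeRing)
open import Function.Bundles using (Func)
open import Relation.Binary.Bundles using (Setoid)
open import Relation.Binary.Core using (Rel)
open import Relation.Binary.Structures using (IsStrictTotalOrder; IsTotalOrder)
open import Relation.Nullary using (¬_)
open import Relation.Unary using (Pred; _∈_; _⊆_; ∅; Satisfiable)
import Algebra.Properties.Monoid.Sum as MonoidSum
import Relation.Binary.Construct.On as On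
import Relation.Binary.Construct.StrictToNonStrict as StrictToNonStrict

module Extrema {ℝ : Set} (_≤_ : Rel ℝ 0ℓ) where
  UpperBound LowerBound : ∀ {ℓ} → Pred ℝ ℓ → Pred ℝ ℓ
  UpperBound A u = ∀ {x} → x ∈ A → x ≤ u
  LowerBound A l = ∀ {x} → x ∈ A → l ≤ x

  IsSup IsInf : ∀ {ℓ} → Pred ℝ ℓ → Pred ℝ ℓ
  IsSup A s = UpperBound A s × (∀ {u} → UpperBound A u → s ≤ u)
  IsInf A i = LowerBound A i × (∀ {l} → LowerBound A l → l ≤ i)

-- The real numbers, given axiomatically: a Dedekind-complete ordered field
-- is determined up to isomorphism.  The inverse is a total function whose
-- value at 0 is unspecified.  Completeness is required for Set₁-valued
-- predicates because the supremum defining opx ranges over subsets of the plane.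
record CompleteOrderedField : Set (lsuc (lsuc 0ℓ)) where
  infix  4 _<_
  infix  8 _⁻¹
  infixl 7 _/_

  field
    commutativeRing : CommutativeRing 0ℓ 0ℓ

  open CommutativeRing commutativeRing public
    using (_≈_; _≉_; _+_; _*_; -_; _-_; 0#; 1#; setoid)
    renaming (Carrier to ℝ)

  field
    _<_                : Rel ℝ 0ℓ
    isStrictTotalOrder : IsStrictTotalOrder _≈_ _<_
    +-monoʳ-<          : ∀ z {x y} → x < y → z + x < z + y
    *-pos              : ∀ {x y} → 0# < x → 0# < y → 0# < x * y
    0≉1                : 0# ≉ 1#
    _⁻¹                : ℝ → ℝ
    ⁻¹-inverseʳ        : ∀ {x} → x ≉ 0# → x * x ⁻¹ ≈ 1#

  open StrictToNonStrict _≈_ _<_ public using (_≤_)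

  _/_ : ℝ → ℝ → ℝ
  x / y = x * y ⁻¹

  open Extrema _≤_ public

  field
    complete : (A : Pred ℝ (lsuc 0ℓ)) →
               Satisfiable A → ∃ (UpperBound A) → ∃ (IsSup A)

  infimum : (A : Pred ℝ 0ℓ) → Satisfiable A → ∃ (LowerBound A) → ∃ (IsInf A)
  infimum A (a , a∈A) (l , lb)
    with complete (λ x → Lift _ (LowerBound A x)) (l , lift lb) (a , λ (lift h) → h a∈A)
  ... | s , ub , least =
    s , (λ x∈A → least (λ (lift h) → h x∈A)) , (λ h → ub (lift h))

module Order (R : CompleteOrderedField) where
  open CompleteOrderedField R
  open CommutativeRing commutativeRing
    using (+-identityʳ; -‿inverseˡ; +-comm; zeroˡ; zeroʳ; *-congˡ; *-congʳ; +-cong)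
    renaming (sym to ≈-sym; trans to ≈-trans; refl to ≈-refl)

  open IsTotalOrder (StrictToNonStrict.isTotalOrder _≈_ _<_ isStrictTotalOrder) public
    using () renaming (refl to ≤-refl; reflexive to ≤-reflexive; trans to ≤-trans)

  +-monoʳ-≤ : ∀ z {x y} → x ≤ y → z + x ≤ z + y
  +-monoʳ-≤ z (inj₁ x<y) = inj₁ (+-monoʳ-< z x<y)
  +-monoʳ-≤ z (inj₂ x≈y) = inj₂ (+-cong ≈-refl x≈y)

  +-nonneg : ∀ {x y} → 0# ≤ x → 0# ≤ y → 0# ≤ x + y
  +-nonneg {x} {y} 0≤x 0≤y =
    ≤-trans 0≤x (≤-trans (≤-reflexive (≈-sym (+-identityʳ x))) (+-monoʳ-≤ x 0≤y))

  *-nonneg : ∀ {x y} → 0# ≤ x → 0# ≤ y → 0# ≤ x * y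
  *-nonneg (inj₁ 0<x) (inj₁ 0<y) = inj₁ (*-pos 0<x 0<y)
  *-nonneg {x} {y} (inj₂ 0≈x) _  = inj₂ (≈-sym (≈-trans (*-congʳ (≈-sym 0≈x)) (zeroˡ y)))
  *-nonneg {x} {y} _ (inj₂ 0≈y)  = inj₂ (≈-sym (≈-trans (*-congˡ (≈-sym 0≈y)) (zeroʳ x)))

  diff-nonneg : ∀ {x y} → x ≤ y → 0# ≤ y - x
  diff-nonneg {x} {y} x≤y =
    ≤-trans (≤-reflexive (≈-sym (-‿inverseˡ x)))
      (≤-trans (+-monoʳ-≤ (- x) x≤y) (≤-reflexive (+-comm (- x) y)))

module Plane (R : CompleteOrderedField) where
  open CompleteOrderedField R public
  open Order R
  open CommutativeRing commutativeRing
    using (+-identityʳ; -‿inverseʳ; zeroˡ; *-congʳ; +-cong; +-monoid)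
    renaming (sym to ≈-sym; trans to ≈-trans; refl to ≈-refl)
  open MonoidSum +-monoid using (sum)

  ℝ² : Set
  ℝ² = ℝ × ℝ

  ℝ⁺ : Set
  ℝ⁺ = Σ[ n ∈ ℝ ] 0# < n

  Subset : Set₁
  Subset = Pred ℝ² 0ℓ

  -- Open in the Euclidean topology.  An open set automatically respects _≈_.
  IsOpen : Subset → Set
  IsOpen S = ∀ {x y} → (x , y) ∈ S →
    ∃[ r ] 0# < r ×
      (∀ {x′ y′} → (x′ - x) * (x′ - x) + (y′ - y) * (y′ - y) < r * r → (x′ , y′) ∈ S)

  xCoords yCoords : Subset → Pred ℝ 0ℓ
  xCoords S x = ∃[ y ] (x , y) ∈ S
  yCoords S y = ∃[ x ] (x , y) ∈ S

  -- Elements are compared by their real value only, so a `Func` out of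
  -- `subsetoid A` cannot depend on the proof of membership in A.
  subsetoid : Pred ℝ 0ℓ → Setoid 0ℓ 0ℓ
  subsetoid A = On.setoid {B = ∃ A} setoid proj₁

  Expanding : ∀ {A B : Pred ℝ 0ℓ} → Func (subsetoid A) (subsetoid B) → Set
  Expanding {A} f = ∀ (a₀ a₁ : ∃ A) → proj₁ a₁ < proj₁ a₀ →
    1# ≤ (proj₁ (to a₀) - proj₁ (to a₁)) / (proj₁ a₀ - proj₁ a₁)
    where open Func f

  _Contains_ : Subset → Subset → Set
  S Contains P =
    Σ[ f ∈ Func (subsetoid (xCoords P)) (subsetoid (xCoords S)) ]
    Σ[ g ∈ Func (subsetoid (yCoords P)) (subsetoid (yCoords S)) ]
      Expanding f × Expanding g ×
      (∀ {x y} (p : (x , y) ∈ P) →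
        (proj₁ (Func.to f (x , y , p)) , proj₁ (Func.to g (y , x , p))) ∈ S)

  _IsFreeOf_ : Subset → Subset → Set
  S IsFreeOf P = ¬ (S Contains P)

  record Box : Set where
    field
      x₀ x₁ y₀ y₁ : ℝ
      x₀≤x₁ : x₀ ≤ x₁
      y₀≤y₁ : y₀ ≤ y₁

    area : ℝ
    area = (x₁ - x₀) * (y₁ - y₀)

    points : Subset
    points (x , y) = (x₀ ≤ x × x ≤ x₁) × (y₀ ≤ y × y ≤ y₁)

  open Box using (area; points)

  PartialSums : (ℕ → ℝ) → Pred ℝ 0ℓ
  PartialSums a t = ∃[ k ] t ≈ sum {k} (λ i → a (toℕ i))

  -- Total areas of countable covers of S by closed boxes; as areas are
  -- nonnegative, the sum of the series is the supremum of its partial sums.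
  CoverSums : Subset → Pred ℝ 0ℓ
  CoverSums S s = Σ[ B ∈ (ℕ → Box) ]
    (∀ {p} → p ∈ S → ∃[ k ] p ∈ points (B k)) ×
    IsSup (PartialSums (λ k → area (B k))) s

  area-nonneg : ∀ Q → 0# ≤ area Q
  area-nonneg Q = *-nonneg (diff-nonneg (Box.x₀≤x₁ Q)) (diff-nonneg (Box.y₀≤y₁ Q))

  coverSum-nonneg : ∀ S → LowerBound (CoverSums S) 0#
  coverSum-nonneg S (_ , _ , ub , _) = ub (0 , ≈-refl)

  pointBox : Box
  pointBox = record
    { x₀ = 0# ; x₁ = 0# ; y₀ = 0# ; y₁ = 0# ; x₀≤x₁ = ≤-refl ; y₀≤y₁ = ≤-refl }

  area-pointBox : area pointBox ≈ 0#
  area-pointBox = ≈-trans (*-congʳ (-‿inverseʳ 0#)) (zeroˡ _)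

  sum-zero : ∀ {k} (v : Vector ℝ k) → (∀ i → v i ≈ 0#) → sum v ≈ 0#
  sum-zero {zero}  v v≈0 = ≈-refl
  sum-zero {suc k} v v≈0 =
    ≈-trans (+-cong (v≈0 fzero) (sum-zero (tail v) (λ i → v≈0 (fsuc i)))) (+-identityʳ 0#)

  coverSum-box : ∀ S Q → S ⊆ points Q → area Q ∈ CoverSums S
  coverSum-box S Q S⊆Q = cover , (λ p → 0 , S⊆Q p) , upper , λ ub → ub (1 , ≈-sym (total 0))
    where
    cover : ℕ → Box
    cover zero    = Q
    cover (suc _) = pointBox

    total : ∀ k → sum {suc k} (λ i → area (cover (toℕ i))) ≈ area Q
    total k = ≈-trans
      (+-cong ≈-refl (sum-zero {k} (λ _ → area pointBox) (λ _ → area-pointBox)))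
      (+-identityʳ _)

    upper : UpperBound (PartialSums (λ k → area (cover k))) (area Q)
    upper (zero  , t≈) = ≤-trans (≤-reflexive t≈) (area-nonneg Q)
    upper (suc k , t≈) = ≤-reflexive (≈-trans t≈ (total k))

  -- Two-dimensional Lebesgue (outer) measure of a bounded set, which is its
  -- Lebesgue measure whenever the set is measurable, in particular if it is open.
  -- The bounding box only ensures that the infimum exists.
  lebesgue : (S : Subset) → ∃[ Q ] S ⊆ points Q → ∃ (IsInf (CoverSums S))
  lebesgue S (Q , S⊆Q) =
    infimum (CoverSums S) (area Q , coverSum-box S Q S⊆Q) (0# , coverSum-nonneg S)

  μ₂ : (S : Subset) → ∃[ Q ] S ⊆ points Q → ℝ
  μ₂ S S-bounded = proj₁ (lebesgue S S-bounded)

  square : ℝ⁺ → Box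
  square (n , 0<n) = record
    { x₀ = 0# ; x₁ = n ; y₀ = 0# ; y₁ = n ; x₀≤x₁ = inj₁ 0<n ; y₀≤y₁ = inj₁ 0<n }

  FreeMeasures : ℝ⁺ → Subset → Pred ℝ (lsuc 0ℓ)
  FreeMeasures n P m = Σ[ S ∈ Subset ]
    IsOpen S × S IsFreeOf P ×
    Σ[ S⊆□ ∈ S ⊆ points (square n) ] m ≈ μ₂ S (square n , S⊆□)

  -- P must be nonempty: every set contains the empty set, so for P = ∅ the
  -- supremum would be over no sets at all.
  opx-isSup : ∀ n P → Satisfiable P → ∃ (IsSup (FreeMeasures n P))
  opx-isSup n P ((x , y) , p) =
    complete (FreeMeasures n P)
      (μ₂ ∅ (square n , λ ()) ,
       ∅ , (λ ()) , (λ (f , _) → proj₂ (proj₂ (Func.to f (x , y , p)))) , (λ ()) , ≈-refl)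
      (area (square n) , λ (S , _ , _ , S⊆□ , m≈) →
        ≤-trans (≤-reflexive m≈)
          (proj₁ (proj₂ (lebesgue S (square n , S⊆□))) (coverSum-box S (square n) S⊆□)))

  opx : ℝ⁺ → (P : Subset) → Satisfiable P → ℝ
  opx n P P-nonempty = proj₁ (opx-isSup n P P-nonempty)

  -- f(n) = Θ(g(n)) as n → ∞ over the positive reals, witnessed by C₁ and C₂.
  _=Θ[_,_]_ : (ℝ⁺ → ℝ) → ℝ → ℝ → (ℝ⁺ → ℝ) → Set
  f =Θ[ C₁ , C₂ ] g = 0# < C₁ × 0# < C₂ ×
    ∃[ n₀ ] (∀ (n : ℝ⁺) → n₀ ≤ proj₁ n → C₁ * g n ≤ f n × f n ≤ C₂ * g n)

{-# OPTIONS --safe #-}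
-- For each n the lower bound needs an open P-free set of area at least n²/2.
-- Take M vertical strips of equal width and admit, over the i-th strip, those
-- y/n whose i-th binary digit is 1 (Rademacher functions).  P contains a fine
-- grid of K × t points.  A copy of it, being stretched, meets K different
-- strips; but only the fraction 2^-K of the 2^M dyadic intervals has the digit
-- 1 in all K places, which is fewer than the t intervals met.  Reflection
-- y ↦ n - y complements all digits, so the set and its mirror image fill the
-- square up to countably many segments, and boxes covering the set have total
-- area at least n²/2.  This last step uses that countably many boxes of total
-- area less than n² do not cover the square: a rectangle in which the boxes
-- have too little area contains a smaller one of the same kind that avoids a
-- given box, and rectangles nested in this way have a common point.
module Submission where

open import Level using (0ℓ; Lift; lift) renaming (suc to lsuc)
open import Algebra.Bundles using (CommutativeRing)
open import Data.Empty using (⊥-elim)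
open import Data.Fin.Base using (Fin; toℕ)
import Data.Fin.Properties as Fin
open import Data.Integer.Base as ℤ using (ℤ; +_; -[1+_])
import Data.Integer.Properties as ℤ
open import Data.List.Base using (List; []; _∷_; length; filter; map; tabulate)
open import Data.List.Membership.Propositional using () renaming (_∈_ to _∈ˡ_)
open import Data.List.Membership.Propositional.Properties using (∈-filter⁻; ∈-map⁻; ∈-tabulate⁻)
open import Data.List.Properties using (length-map; length-tabulate)
open import Data.List.Relation.Unary.All as All using (All; []; _∷_)
open import Data.List.Relation.Unary.AllPairs as AllPairs using (AllPairs; []; _∷_)
import Data.List.Relation.Unary.AllPairs.Properties as AllPairs
open import Data.List.Relation.Unary.Any using (here; there)
open import Data.Maybe.Base using (Maybe; just; nothing)
open import Data.Nat.Base as ℕ using (ℕ; zero; suc)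
import Data.Nat.Properties as ℕ
open import Data.Product using (Σ; Σ-syntax; ∃-syntax; _,_; _×_; proj₁; proj₂)
open import Data.Sum using (_⊎_; inj₁; inj₂; [_,_]′)
open import Function.Base using (_∘_)
open import Function.Bundles using (Func)
open import Relation.Binary.Bundles using (StrictPartialOrder; TotalOrder)
open import Relation.Binary.Definitions using (tri<; tri≈; tri>)
open import Relation.Binary.PropositionalEquality as ≡ using (_≡_)
open import Relation.Binary.Structures using (IsStrictTotalOrder)
import Relation.Binary.Construct.StrictToNonStrict as StrictToNonStrict
open import Relation.Nullary using (¬_; yes; no)
open import Relation.Nullary.Decidable using (¬?)
open import Relation.Unary using (Pred; Decidable; Satisfiable; _∈_; _⊆_; ∅; _∪_; _∩_)
open import Defs

-- A ring solver with integer coefficients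

module IntegerCoefficients (R : CommutativeRing 0ℓ 0ℓ) where
  open import Algebra.Solver.Ring.AlmostCommutativeRing
    using (_-Raw-AlmostCommutative⟶_; fromCommutativeRing)
  open CommutativeRing R
  open import Algebra.Properties.Ring ring using (-‿distribˡ-*; -‿distribʳ-*)
  open import Algebra.Properties.AbelianGroup +-abelianGroup
    using () renaming (⁻¹-∙-comm to -‿+-comm; ⁻¹-involutive to -‿involutive; ε⁻¹≈ε to -0≈0)
  open import Algebra.Properties.Semiring.Mult semiring using (×-homo-+; ×1-homo-*) renaming (_×_ to _·_)
  open import Algebra.Properties.CommutativeSemigroup +-commutativeSemigroup using (interchange)
  open import Relation.Binary.Reasoning.Setoid setoid

  ⟦_⟧ᶻ : ℤ → Carrier
  ⟦ + n ⟧ᶻ      = n · 1#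
  ⟦ -[1+ n ] ⟧ᶻ = - (ℕ.suc n · 1#)

  ⊖-homo : ∀ m n → ⟦ m ℤ.⊖ n ⟧ᶻ ≈ m · 1# - n · 1#
  ⊖-homo m ℕ.zero = sym (trans (+-congˡ -0≈0) (+-identityʳ _))
  ⊖-homo ℕ.zero (ℕ.suc n) = sym (+-identityˡ _)
  ⊖-homo (ℕ.suc m) (ℕ.suc n) = begin
    ⟦ ℕ.suc m ℤ.⊖ ℕ.suc n ⟧ᶻ               ≡⟨ ≡.cong ⟦_⟧ᶻ (ℤ.[1+m]⊖[1+n]≡m⊖n m n) ⟩
    ⟦ m ℤ.⊖ n ⟧ᶻ                           ≈⟨ ⊖-homo m n ⟩
    m · 1# - n · 1#                        ≈⟨ +-identityˡ _ ⟨
    0# + (m · 1# - n · 1#)                 ≈⟨ +-congʳ (-‿inverseʳ 1#) ⟨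
    (1# - 1#) + (m · 1# - n · 1#)          ≈⟨ interchange _ _ _ _ ⟩
    (1# + m · 1#) + (- 1# - n · 1#)        ≈⟨ +-congˡ (-‿+-comm _ _) ⟩
    ℕ.suc m · 1# - ℕ.suc n · 1#            ∎

  -‿homo : ∀ i → ⟦ ℤ.- i ⟧ᶻ ≈ - ⟦ i ⟧ᶻ
  -‿homo (+ ℕ.zero)  = sym -0≈0
  -‿homo (+ ℕ.suc n) = refl
  -‿homo -[1+ n ]    = sym (-‿involutive _)

  +-homo : ∀ i j → ⟦ i ℤ.+ j ⟧ᶻ ≈ ⟦ i ⟧ᶻ + ⟦ j ⟧ᶻ
  +-homo (+ m)    (+ n)    = ×-homo-+ 1# m n
  +-homo (+ m)    -[1+ n ] = ⊖-homo m (ℕ.suc n)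
  +-homo -[1+ m ] (+ n)    = trans (⊖-homo n (ℕ.suc m)) (+-comm _ _)
  +-homo -[1+ m ] -[1+ n ] = begin
    - (ℕ.suc (ℕ.suc (m ℕ.+ n)) · 1#)       ≡⟨ ≡.cong (λ k → - (ℕ.suc k · 1#)) (ℕ.+-suc m n) ⟨
    - ((ℕ.suc m ℕ.+ ℕ.suc n) · 1#)         ≈⟨ -‿cong (×-homo-+ 1# (ℕ.suc m) (ℕ.suc n)) ⟩
    - (ℕ.suc m · 1# + ℕ.suc n · 1#)        ≈⟨ -‿+-comm _ _ ⟨
    - (ℕ.suc m · 1#) - ℕ.suc n · 1#        ∎

  *-homo-+ : ∀ m j → ⟦ + m ℤ.* j ⟧ᶻ ≈ m · 1# * ⟦ j ⟧ᶻ
  *-homo-+ m (+ n) = begin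
    ⟦ + m ℤ.* + n ⟧ᶻ     ≡⟨ ≡.cong ⟦_⟧ᶻ (ℤ.pos-* m n) ⟨
    (m ℕ.* n) · 1#       ≈⟨ ×1-homo-* m n ⟩
    m · 1# * (n · 1#)    ∎
  *-homo-+ m -[1+ n ] = begin
    ⟦ + m ℤ.* -[1+ n ] ⟧ᶻ          ≡⟨ ≡.cong ⟦_⟧ᶻ (ℤ.neg-distribʳ-* (+ m) (+ ℕ.suc n)) ⟨
    ⟦ ℤ.- (+ m ℤ.* + ℕ.suc n) ⟧ᶻ   ≈⟨ -‿homo (+ m ℤ.* + ℕ.suc n) ⟩
    - ⟦ + m ℤ.* + ℕ.suc n ⟧ᶻ       ≈⟨ -‿cong (*-homo-+ m (+ ℕ.suc n)) ⟩
    - (m · 1# * (ℕ.suc n · 1#))    ≈⟨ -‿distribʳ-* _ _ ⟩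
    m · 1# * - (ℕ.suc n · 1#)      ∎

  *-homo : ∀ i j → ⟦ i ℤ.* j ⟧ᶻ ≈ ⟦ i ⟧ᶻ * ⟦ j ⟧ᶻ
  *-homo (+ m) j = *-homo-+ m j
  *-homo -[1+ m ] j = begin
    ⟦ -[1+ m ] ℤ.* j ⟧ᶻ          ≡⟨ ≡.cong ⟦_⟧ᶻ (ℤ.neg-distribˡ-* (+ ℕ.suc m) j) ⟨
    ⟦ ℤ.- (+ ℕ.suc m ℤ.* j) ⟧ᶻ   ≈⟨ -‿homo (+ ℕ.suc m ℤ.* j) ⟩
    - ⟦ + ℕ.suc m ℤ.* j ⟧ᶻ       ≈⟨ -‿cong (*-homo-+ (ℕ.suc m) j) ⟩
    - (ℕ.suc m · 1# * ⟦ j ⟧ᶻ)    ≈⟨ -‿distribˡ-* _ _ ⟩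
    - (ℕ.suc m · 1#) * ⟦ j ⟧ᶻ    ∎

  morphism : ℤ.+-*-rawRing -Raw-AlmostCommutative⟶ fromCommutativeRing R
  morphism = record
    { ⟦_⟧ = ⟦_⟧ᶻ ; +-homo = +-homo ; *-homo = *-homo ; -‿homo = -‿homo
    ; 0-homo = refl ; 1-homo = +-identityʳ 1# }

  -- Coefficients are compared in `ℤ`, where equality is decidable; `nothing` makes no claim that
  -- the images differ.
  ≈-if-≡ : ∀ i j → Maybe (⟦ i ⟧ᶻ ≈ ⟦ j ⟧ᶻ)
  ≈-if-≡ i j with i ℤ.≟ j
  ... | yes i≡j = just (reflexive (≡.cong ⟦_⟧ᶻ i≡j))
  ... | no  _   = nothing

  open import Algebra.Solver.Ring ℤ.+-*-rawRing (fromCommutativeRing R) morphism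
    ≈-if-≡ public using (solve; _:=_; _:+_; _:*_; _:-_; :-_; con)

-- Arithmetic of a complete ordered field

module OrderedField (R : CompleteOrderedField) where
  open CompleteOrderedField R public
  open Order R public
  open CommutativeRing commutativeRing public
    using (+-cong; +-congˡ; +-congʳ; *-congˡ; *-congʳ; *-cong; -‿cong; +-comm; *-comm;
           +-identityˡ; +-identityʳ; *-identityˡ; *-identityʳ; zeroˡ; -‿inverseʳ;
           +-monoid; +-commutativeMonoid; semiring)
    renaming (refl to ≈-refl; sym to ≈-sym; trans to ≈-trans)
  open IsStrictTotalOrder isStrictTotalOrder public
    using (compare; _<?_; asym; irrefl; isStrictPartialOrder; <-respʳ-≈; <-respˡ-≈)
    renaming (trans to <-trans)
  open import Algebra.Properties.Semiring.Mult semiring public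
    using (×-homo-+; ×-assocˡ; ×-congʳ; ×-congˡ; ×-homo-1) renaming (_×_ to _·_)
  open IntegerCoefficients commutativeRing public
    using (solve; _:=_; _:+_; _:*_; _:-_; :-_; con)

  strictPartialOrder : StrictPartialOrder 0ℓ 0ℓ 0ℓ
  strictPartialOrder = record { isStrictPartialOrder = isStrictPartialOrder }

  totalOrder : TotalOrder 0ℓ 0ℓ 0ℓ
  totalOrder = record { isTotalOrder = StrictToNonStrict.isTotalOrder _≈_ _<_ isStrictTotalOrder }

  module ≤-Reasoning where
    open import Relation.Binary.Reasoning.StrictPartialOrder strictPartialOrder public
  open ≤-Reasoning

  open import Algebra.Construct.NaturalChoice.Min totalOrder public
    using (_⊓_; x⊓y≤x; x⊓y≤y; ⊓-sel; ⊓-monoʳ-≤; x≤y⇒y⊓x≈x)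
  open import Algebra.Construct.NaturalChoice.Max totalOrder public
    using (_⊔_; x≤x⊔y; ⊔-lub; ⊔-monoʳ-≤; x≤y⇒x⊔y≈y)

  ≮⇒≥ : ∀ {x y} → ¬ (x < y) → y ≤ x
  ≮⇒≥ {x} {y} x≮y with compare x y
  ... | tri< x<y _ _ = ⊥-elim (x≮y x<y)
  ... | tri≈ _ x≈y _ = inj₂ (≈-sym x≈y)
  ... | tri> _ _ y<x = inj₁ y<x

  <⇒≱ : ∀ {x y} → x < y → ¬ (y ≤ x)
  <⇒≱ x<y (inj₁ y<x) = asym x<y y<x
  <⇒≱ x<y (inj₂ y≈x) = irrefl (≈-sym y≈x) x<y

  <-≤-trans : ∀ {x y z} → x < y → y ≤ z → x < z
  <-≤-trans = StrictToNonStrict.<-≤-trans _≈_ _<_ <-trans <-respʳ-≈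

  ≤-<-trans : ∀ {x y z} → x ≤ y → y < z → x < z
  ≤-<-trans = StrictToNonStrict.≤-<-trans _≈_ _<_ ≈-sym <-trans <-respˡ-≈

  <⇒0<- : ∀ {x y} → x < y → 0# < y - x
  <⇒0<- {x} {y} x<y = begin-strict
    0#       ≈⟨ solve 1 (λ x → con (+ 0) := :- x :+ x) ≈-refl x ⟩
    - x + x  <⟨ +-monoʳ-< (- x) x<y ⟩
    - x + y  ≈⟨ +-comm _ _ ⟩
    y - x    ∎

  0<-⇒< : ∀ {x y d} → 0# < d → d ≈ y - x → x < y
  0<-⇒< {x} {y} {d} 0<d d≈y-x = begin-strict
    x            ≈⟨ +-identityʳ x ⟨
    x + 0#       <⟨ +-monoʳ-< x 0<d ⟩
    x + d        ≈⟨ +-congˡ d≈y-x ⟩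
    x + (y - x)  ≈⟨ solve 2 (λ x y → x :+ (y :- x) := y) ≈-refl x y ⟩
    y            ∎

  0≤-⇒≤ : ∀ {x y d} → 0# ≤ d → d ≈ y - x → x ≤ y
  0≤-⇒≤ {x} {y} {d} 0≤d d≈y-x = begin
    x            ≈⟨ +-identityʳ x ⟨
    x + 0#       ≤⟨ +-monoʳ-≤ x 0≤d ⟩
    x + d        ≈⟨ +-congˡ d≈y-x ⟩
    x + (y - x)  ≈⟨ solve 2 (λ x y → x :+ (y :- x) := y) ≈-refl x y ⟩
    y            ∎

  +-mono-≤ : ∀ {a b c d} → a ≤ b → c ≤ d → a + c ≤ b + d
  +-mono-≤ {a} {b} {c} {d} a≤b c≤d = 0≤-⇒≤ (+-nonneg (diff-nonneg a≤b) (diff-nonneg c≤d))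
    (solve 4 (λ a b c d → (b :- a) :+ (d :- c) := (b :+ d) :- (a :+ c)) ≈-refl a b c d)

  +-mono-<-≤ : ∀ {a b c d} → a < b → c ≤ d → a + c < b + d
  +-mono-<-≤ {a} {b} {c} {d} a<b c≤d = begin-strict
    a + c  ≤⟨ +-monoʳ-≤ a c≤d ⟩
    a + d  ≈⟨ +-comm a d ⟩
    d + a  <⟨ +-monoʳ-< d a<b ⟩
    d + b  ≈⟨ +-comm d b ⟩
    b + d  ∎

  -‿anti-≤ : ∀ {x y} → x ≤ y → - y ≤ - x
  -‿anti-≤ {x} {y} x≤y = 0≤-⇒≤ (diff-nonneg x≤y)
    (solve 2 (λ x y → y :- x := :- x :- :- y) ≈-refl x y)

  +-cancelʳ-≤ : ∀ z {x y} → x + z ≤ y + z → x ≤ y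
  +-cancelʳ-≤ z {x} {y} x+z≤y+z = 0≤-⇒≤ (diff-nonneg x+z≤y+z)
    (solve 3 (λ x y z → (y :+ z) :- (x :+ z) := y :- x) ≈-refl x y z)

  +-pos : ∀ {x y} → 0# < x → 0# ≤ y → 0# < x + y
  +-pos {x} {y} 0<x 0≤y = begin-strict
    0#       ≈⟨ +-identityʳ 0# ⟨
    0# + 0#  <⟨ +-mono-<-≤ 0<x 0≤y ⟩
    x + y    ∎

  *-monoˡ-≤ : ∀ {x y z} → 0# ≤ z → x ≤ y → x * z ≤ y * z
  *-monoˡ-≤ {x} {y} {z} 0≤z x≤y = 0≤-⇒≤ (*-nonneg (diff-nonneg x≤y) 0≤z)
    (solve 3 (λ x y z → (y :- x) :* z := y :* z :- x :* z) ≈-refl x y z)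

  *-mono-≤ : ∀ {a b c d} → 0# ≤ a → 0# ≤ d → a ≤ b → c ≤ d → a * c ≤ b * d
  *-mono-≤ {a} {b} {c} {d} 0≤a 0≤d a≤b c≤d = begin
    a * c  ≈⟨ *-comm a c ⟩
    c * a  ≤⟨ *-monoˡ-≤ 0≤a c≤d ⟩
    d * a  ≈⟨ *-comm d a ⟩
    a * d  ≤⟨ *-monoˡ-≤ 0≤d a≤b ⟩
    b * d  ∎

  *-cancelʳ-< : ∀ {x y z} → 0# ≤ z → x * z < y * z → x < y
  *-cancelʳ-< {x} {y} 0≤z xz<yz with x <? y
  ... | yes x<y = x<y
  ... | no x≮y  = ⊥-elim (<⇒≱ xz<yz (*-monoˡ-≤ 0≤z (≮⇒≥ x≮y)))

  0≤x*x : ∀ x → 0# ≤ x * x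
  0≤x*x x with compare 0# x
  ... | tri< 0<x _ _ = inj₁ (*-pos 0<x 0<x)
  ... | tri≈ _ 0≈x _ = inj₂ (≈-sym (≈-trans (*-congʳ (≈-sym 0≈x)) (zeroˡ x)))
  ... | tri> _ _ x<0 = ≤-trans (inj₁ (*-pos 0<-x 0<-x))
    (inj₂ (solve 1 (λ x → (:- x) :* (:- x) := x :* x) ≈-refl x))
    where
    0<-x : 0# < - x
    0<-x = <-respʳ-≈ (+-identityˡ (- x)) (<⇒0<- x<0)

  sq-cancel-< : ∀ {x y} → 0# ≤ y → x * x < y * y → x < y
  sq-cancel-< {x} {y} 0≤y xx<yy with x <? y
  ... | yes x<y = x<y
  ... | no x≮y  = ⊥-elim (<⇒≱ xx<yy (*-mono-≤ 0≤y (≤-trans 0≤y y≤x) y≤x y≤x))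
    where y≤x = ≮⇒≥ x≮y

  0<1 : 0# < 1#
  0<1 with compare 0# 1#
  ... | tri< 0<1 _ _ = 0<1
  ... | tri≈ _ 0≈1 _ = ⊥-elim (0≉1 0≈1)
  ... | tri> _ _ 1<0 = ⊥-elim (<⇒≱ 1<0 (≤-trans (0≤x*x 1#) (inj₂ (*-identityʳ 1#))))

  <⇒≉0 : ∀ {x} → 0# < x → x ≉ 0#
  <⇒≉0 0<x x≈0 = irrefl (≈-sym x≈0) 0<x

  ⁻¹-pos : ∀ {x} → 0# < x → 0# < x ⁻¹
  ⁻¹-pos {x} 0<x with 0# <? x ⁻¹
  ... | yes 0<x⁻¹ = 0<x⁻¹
  ... | no 0≮x⁻¹  = ⊥-elim (<⇒≱ 0<1 (begin
    1#          ≈⟨ ⁻¹-inverseʳ (<⇒≉0 0<x) ⟨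
    x * x ⁻¹    ≈⟨ *-comm _ _ ⟩
    x ⁻¹ * x    ≤⟨ *-monoˡ-≤ (inj₁ 0<x) (≮⇒≥ 0≮x⁻¹) ⟩
    0# * x      ≈⟨ zeroˡ x ⟩
    0#          ∎))

  ½ : ℝ
  ½ = (1# + 1#) ⁻¹

  0<2 : 0# < 1# + 1#
  0<2 = +-pos 0<1 (inj₁ 0<1)

  0<½ : 0# < ½
  0<½ = ⁻¹-pos 0<2

  ½+½ : ∀ x → ½ * x + ½ * x ≈ x
  ½+½ x = begin-equality
    ½ * x + ½ * x     ≈⟨ solve 2 (λ h x → h :* x :+ h :* x := (con (+ 1) :+ con (+ 1)) :* h :* x) ≈-refl ½ x ⟩
    (1# + 0# + (1# + 0#)) * ½ * x  ≈⟨ *-congʳ (*-congʳ (+-cong (+-identityʳ 1#) (+-identityʳ 1#))) ⟩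
    (1# + 1#) * ½ * x ≈⟨ *-congʳ (⁻¹-inverseʳ (<⇒≉0 0<2)) ⟩
    1# * x            ≈⟨ *-identityˡ x ⟩
    x                 ∎

  halve-≤ : ∀ {x y} → x ≤ y + y → ½ * x ≤ y
  halve-≤ {x} {y} x≤2y with y <? ½ * x
  ... | no y≮½x  = ≮⇒≥ y≮½x
  ... | yes y<½x = ⊥-elim (<⇒≱ (+-mono-<-≤ y<½x (inj₁ y<½x)) (≤-trans (inj₂ (½+½ x)) x≤2y))

  ·-nonneg : ∀ m {x} → 0# ≤ x → 0# ≤ m · x
  ·-nonneg zero    0≤x = ≤-refl
  ·-nonneg (suc m) 0≤x = +-nonneg 0≤x (·-nonneg m 0≤x)

  ·-monoˡ-≤ : ∀ {m n x} → 0# ≤ x → m ℕ.≤ n → m · x ≤ n · x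
  ·-monoˡ-≤ {n = n} 0≤x ℕ.z≤n       = ·-nonneg n 0≤x
  ·-monoˡ-≤ {x = x} 0≤x (ℕ.s≤s m≤n) = +-monoʳ-≤ x (·-monoˡ-≤ 0≤x m≤n)

  halved : ℕ → ℝ → ℝ
  halved zero    x = x
  halved (suc k) x = ½ * halved k x

  halved-pos : ∀ k {x} → 0# < x → 0# < halved k x
  halved-pos zero    0<x = 0<x
  halved-pos (suc k) 0<x = *-pos 0<½ (halved-pos k 0<x)

  -- Since `halved k x` is x / 2^k, `k` doublings undo `k` of the `k + j` halvings.
  2^·halved : ∀ k j x → (2 ℕ.^ k) · halved (k ℕ.+ j) x ≈ halved j x
  2^·halved zero    j x = ×-homo-1 _
  2^·halved (suc k) j x = begin-equality
    (2 ℕ.* 2 ℕ.^ k) · (½ * y)    ≈⟨ ×-congˡ (ℕ.*-comm 2 (2 ℕ.^ k)) ⟩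
    (2 ℕ.^ k ℕ.* 2) · (½ * y)    ≈⟨ ×-assocˡ _ (2 ℕ.^ k) 2 ⟨
    (2 ℕ.^ k) · (2 · (½ * y))    ≈⟨ ×-congʳ (2 ℕ.^ k) (+-congˡ (+-identityʳ _)) ⟩
    (2 ℕ.^ k) · (½ * y + ½ * y)  ≈⟨ ×-congʳ (2 ℕ.^ k) (½+½ y) ⟩
    (2 ℕ.^ k) · y                ≈⟨ 2^·halved k j x ⟩
    halved j x                   ∎
    where y = halved (k ℕ.+ j) x

-- Points outside countably many rectangles

module Escape (R : CompleteOrderedField) where
  open OrderedField R
  open ≤-Reasoning

  -- A form of the Archimedean property. The infimum i of the numbers x / 2^k satisfies i ≤ x /
  -- 2^(k+1), hence i + i ≤ x / 2^k for all k and so i + i ≤ i, whereas 0 < e ≤ i.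
  halved-small : ∀ {e x} → 0# < e → ¬ (∀ k → e ≤ halved k x)
  halved-small {e} {x} 0<e e≤ with infimum (λ y → ∃[ k ] y ≈ halved k x) (x , 0 , ≈-refl)
    (e , λ (k , y≈) → ≤-trans (e≤ k) (inj₂ (≈-sym y≈)))
  ... | i , lower , greatest = <⇒≱ (<-≤-trans 0<e (greatest λ (k , y≈) → ≤-trans (e≤ k) (inj₂ (≈-sym y≈)))) i≤0
    where
    i+i≤ : ∀ k → i + i ≤ halved k x
    i+i≤ k = ≤-trans (+-mono-≤ i≤½ i≤½) (inj₂ (½+½ _))
      where i≤½ = lower (suc k , ≈-refl)

    i≤0 : i ≤ 0#
    i≤0 = +-cancelʳ-≤ i (≤-trans (greatest λ (k , y≈) → ≤-trans (i+i≤ k) (inj₂ (≈-sym y≈)))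
      (inj₂ (≈-sym (+-identityˡ i))))

  record Interval : Set where
    constructor interval
    field
      {lo hi} : ℝ
      lo≤hi   : lo ≤ hi

    width : ℝ
    width = hi - lo

    width-nonneg : 0# ≤ width
    width-nonneg = diff-nonneg lo≤hi

  open Interval

  infix 4 _∈ᴵ_ _⊑_
  _∈ᴵ_ : ℝ → Interval → Set
  x ∈ᴵ I = lo I ≤ x × x ≤ hi I

  _⊑_ : Interval → Interval → Set
  I ⊑ J = lo J ≤ lo I × hi I ≤ hi J

  Disjoint : Interval → Interval → Set
  Disjoint I J = ∀ {x} → x ∈ᴵ I → ¬ (x ∈ᴵ J)

  ⊑-refl : ∀ {I} → I ⊑ I
  ⊑-refl = ≤-refl , ≤-refl

  ⊑-trans : ∀ {I J K} → I ⊑ J → J ⊑ K → I ⊑ K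
  ⊑-trans (a , b) (c , d) = ≤-trans c a , ≤-trans b d

  -- An `Interval` carries a proof of `lo ≤ hi`, on which `v` might depend; therefore all three
  -- order proofs are quantified.
  Superadditive : (Interval → ℝ) → Set
  Superadditive v = ∀ {a t b} (a≤t : a ≤ t) (t≤b : t ≤ b) (a≤b : a ≤ b) →
    v (interval a≤t) + v (interval t≤b) ≤ v (interval a≤b)

  module _ (I : ℕ → Interval) (shrinks : ∀ k → I (suc k) ⊑ I k) where
    nested : ∀ j k → I (j ℕ.+ k) ⊑ I k
    nested zero    k = ⊑-refl {I k}
    nested (suc j) k = ⊑-trans {I (suc j ℕ.+ k)} {I (j ℕ.+ k)} {I k} (shrinks (j ℕ.+ k)) (nested j k)

    lo≤hi-nested : ∀ j k → lo (I j) ≤ hi (I k)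
    lo≤hi-nested j k = begin
      lo (I j)          ≤⟨ proj₁ (nested k j) ⟩
      lo (I (k ℕ.+ j))  ≡⟨ ≡.cong (λ i → lo (I i)) (ℕ.+-comm k j) ⟩
      lo (I (j ℕ.+ k))  ≤⟨ lo≤hi (I (j ℕ.+ k)) ⟩
      hi (I (j ℕ.+ k))  ≤⟨ proj₂ (nested j k) ⟩
      hi (I k)          ∎

    -- The supremum of the left ends serves: by nesting, every right end is an upper bound of all
    -- left ends.
    common-point : ∃[ x ] (∀ k → x ∈ᴵ I k)
    common-point
      with complete (λ x → Lift _ (∃[ k ] x ≈ lo (I k))) (lo (I 0) , lift (0 , ≈-refl))
             (hi (I 0) , λ (lift (k , x≈)) → ≤-trans (inj₂ x≈) (lo≤hi-nested k 0))
    ... | x , upper , least = x , λ k → upper (lift (k , ≈-refl)) ,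
      least λ (lift (j , x≈)) → ≤-trans (inj₂ x≈) (lo≤hi-nested j k)

  -- v and w play the role of I ↦ V (I × J) and |J| for a fixed side J of a
  -- rectangle; I is light when V (I × J) falls short of the area |I| |J|.
  module Linear (v : Interval → ℝ) (v-nonneg : ∀ I → 0# ≤ v I) (v-super : Superadditive v)
                (w : ℝ) (0≤w : 0# ≤ w) where

    Light : Interval → Set
    Light I = v I < width I * w

    cut : ∀ {a t b} (a≤t : a ≤ t) (t≤b : t ≤ b) (a≤b : a ≤ b) → Light (interval a≤b) →
          Light (interval a≤t) ⊎ Light (interval t≤b)
    cut {a} {t} {b} a≤t t≤b a≤b light with v (interval a≤t) <? (t - a) * w
    ... | yes left = inj₁ left
    ... | no ¬left with v (interval t≤b) <? (b - t) * w
    ...   | yes right = inj₂ right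
    ...   | no ¬right = ⊥-elim (<⇒≱ light (begin
      (b - a) * w                          ≈⟨ solve 4 (λ a t b w → (b :- a) :* w := (t :- a) :* w :+ (b :- t) :* w) ≈-refl a t b w ⟩
      (t - a) * w + (b - t) * w            ≤⟨ +-mono-≤ (≮⇒≥ ¬left) (≮⇒≥ ¬right) ⟩
      v (interval a≤t) + v (interval t≤b)  ≤⟨ v-super a≤t t≤b a≤b ⟩
      v (interval a≤b)                     ∎))

    -- A light interval stays light after removal of a short piece at an end,
    -- since v only decreases.
    slack : ∀ I → Light I → ∃[ τ ] 0# < τ × τ ≤ width I × v I < (width I - τ) * w
    slack I light = τ , 0<τ , inj₁ τ<ℓ , v<
      where
      ℓ = width I
      -- With w ≤ 0 the area would be at most 0 ≤ `v I`, contrary to lightness.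
      0<w : 0# < w
      0<w with 0# <? w
      ... | yes 0<w = 0<w
      ... | no 0≮w  = ⊥-elim (<⇒≱ (≤-<-trans (v-nonneg I) light) (begin
        ℓ * w   ≈⟨ *-comm ℓ w ⟩
        w * ℓ   ≤⟨ *-monoˡ-≤ (width-nonneg I) (≮⇒≥ 0≮w) ⟩
        0# * ℓ  ≈⟨ zeroˡ ℓ ⟩
        0#      ∎))
      -- Half the deficit of `I`. A piece of width `τ` has area `g`, so the other half of the
      -- deficit survives its removal.
      g = ½ * (ℓ * w - v I)
      0<g : 0# < g
      0<g = *-pos 0<½ (<⇒0<- light)
      τ = g * w ⁻¹
      0<τ : 0# < τ
      0<τ = *-pos 0<g (⁻¹-pos 0<w)
      τw≈g : τ * w ≈ g
      τw≈g = begin-equality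
        g * w ⁻¹ * w    ≈⟨ solve 3 (λ g i w → g :* i :* w := g :* (w :* i)) ≈-refl g (w ⁻¹) w ⟩
        g * (w * w ⁻¹)  ≈⟨ *-congˡ (⁻¹-inverseʳ (<⇒≉0 0<w)) ⟩
        g * 1#          ≈⟨ ≈-trans (*-comm g 1#) (*-identityˡ g) ⟩
        g               ∎
      v< : v I < (ℓ - τ) * w
      v< = 0<-⇒< 0<g (begin-equality
        g                          ≈⟨ solve 2 (λ g d → g := g :+ g :- g) ≈-refl g g ⟩
        g + g - g                  ≈⟨ +-cong (½+½ _) (-‿cong (≈-sym τw≈g)) ⟩
        ℓ * w - v I - τ * w        ≈⟨ solve 4 (λ ℓ w v τ → ℓ :* w :- v :- τ :* w := (ℓ :- τ) :* w :- v) ≈-refl ℓ w (v I) τ ⟩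
        (ℓ - τ) * w - v I          ∎)
      0<ℓ-τ : 0# < ℓ - τ
      0<ℓ-τ = *-cancelʳ-< 0≤w (≤-<-trans (≤-trans (inj₂ (zeroˡ w)) (v-nonneg I)) v<)
      τ<ℓ : τ < ℓ
      τ<ℓ = 0<-⇒< 0<ℓ-τ ≈-refl

    module _ {a b} (a≤b : a ≤ b) (light : Light (interval a≤b)) where
      private
        I = interval a≤b
        τ = proj₁ (slack I light)
        0<τ = proj₁ (proj₂ (slack I light))
        τ≤b-a = proj₁ (proj₂ (proj₂ (slack I light)))
        v< = proj₂ (proj₂ (proj₂ (slack I light)))

      -- The strict gap before `b` separates the result from a closed interval that begins at `b`; a
      -- mere cut would leave a common endpoint.
      trimʳ : Σ[ I′ ∈ Interval ] I′ ⊑ I × hi I′ < b × Light I′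
      trimʳ = L , (≤-refl , inj₁ b-τ<b) , b-τ<b , (begin-strict
        v L                  ≈⟨ +-identityʳ (v L) ⟨
        v L + 0#             ≤⟨ +-monoʳ-≤ (v L) (v-nonneg (interval b-τ≤b)) ⟩
        v L + v (interval b-τ≤b)   ≤⟨ v-super a≤b-τ b-τ≤b a≤b ⟩
        v I                  <⟨ v< ⟩
        (b - a - τ) * w      ≈⟨ *-congʳ (swap a b τ) ⟩
        (b - τ - a) * w      ∎)
        where
        swap : ∀ a b τ → b - a - τ ≈ b - τ - a
        swap = solve 3 (λ a b τ → b :- a :- τ := b :- τ :- a) ≈-refl
        a≤b-τ : a ≤ b - τ
        a≤b-τ = 0≤-⇒≤ (diff-nonneg τ≤b-a) (swap a b τ)
        b-τ<b : b - τ < b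
        b-τ<b = 0<-⇒< 0<τ (solve 2 (λ b τ → τ := b :- (b :- τ)) ≈-refl b τ)
        b-τ≤b : b - τ ≤ b
        b-τ≤b = inj₁ b-τ<b
        L = interval a≤b-τ

      trimˡ : Σ[ I′ ∈ Interval ] I′ ⊑ I × a < lo I′ × Light I′
      trimˡ = R′ , (inj₁ a<a+τ , ≤-refl) , a<a+τ , (begin-strict
        v R′                  ≈⟨ +-identityˡ (v R′) ⟨
        0# + v R′             ≤⟨ +-mono-≤ (v-nonneg (interval a≤a+τ)) ≤-refl ⟩
        v (interval a≤a+τ) + v R′   ≤⟨ v-super a≤a+τ a+τ≤b a≤b ⟩
        v I                  <⟨ v< ⟩
        (b - a - τ) * w      ≈⟨ *-congʳ (swap a b τ) ⟩
        (b - (a + τ)) * w    ∎)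
        where
        swap : ∀ a b τ → b - a - τ ≈ b - (a + τ)
        swap = solve 3 (λ a b τ → b :- a :- τ := b :- (a :+ τ)) ≈-refl
        a+τ≤b : a + τ ≤ b
        a+τ≤b = 0≤-⇒≤ (diff-nonneg τ≤b-a) (swap a b τ)
        a<a+τ : a < a + τ
        a<a+τ = 0<-⇒< 0<τ (solve 2 (λ a τ → τ := a :+ τ :- a) ≈-refl a τ)
        a≤a+τ : a ≤ a + τ
        a≤a+τ = inj₁ a<a+τ
        R′ = interval a+τ≤b

    disjointʳ : ∀ {I T} → hi I < lo T → Disjoint I T
    disjointʳ hi<lo (_ , x≤hi) (lo≤x , _) = <⇒≱ hi<lo (≤-trans lo≤x x≤hi)

    disjointˡ : ∀ {I T} → hi T < lo I → Disjoint I T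
    disjointˡ hi<lo (lo≤x , _) (_ , x≤hi) = <⇒≱ hi<lo (≤-trans lo≤x x≤hi)

    -- If the smaller interval ends up inside `T`, the other side of the rectangle has to do the
    -- avoiding.
    Avoidance : Interval → Interval → Set
    Avoidance I T = Σ[ I′ ∈ Interval ] I′ ⊑ I × Light I′ × (Disjoint I′ T ⊎ I′ ⊑ T)

    -- A cut at `hi T` leaves a left piece inside `T` and a right piece that can be trimmed to lie
    -- strictly beyond `T`; one of the two is light.
    avoid-hi : ∀ I T → lo T ≤ lo I → Light I → Avoidance I T
    avoid-hi I T T≤I light with hi T <? lo I | hi T <? hi I
    ... | yes T<I | _          = I , ⊑-refl {I} , light , inj₁ (disjointˡ {I} {T} T<I)
    ... | no _    | no hiT≮hiI = I , ⊑-refl {I} , light , inj₂ (T≤I , ≮⇒≥ hiT≮hiI)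
    ... | no T≮I  | yes hiT<hiI = [ inside , beyond ]′ (cut loI≤hiT (inj₁ hiT<hiI) (lo≤hi I) light)
      where
      loI≤hiT = ≮⇒≥ T≮I

      inside : Light (interval loI≤hiT) → Avoidance I T
      inside left = interval loI≤hiT , (≤-refl , inj₁ hiT<hiI) , left , inj₂ (T≤I , ≤-refl)

      beyond : Light (interval (inj₁ hiT<hiI)) → Avoidance I T
      beyond right = let I′ , (a , b) , T<I′ , light′ = trimˡ (inj₁ hiT<hiI) right in
        I′ , (≤-trans loI≤hiT a , b) , light′ , inj₁ (disjointˡ {I′} {T} T<I′)

    -- If `I` begins before `T`, a cut at `lo T` splits off the part before `T`; the rest begins at
    -- `lo T`, as `avoid-hi` requires.
    avoid : ∀ I T → Light I → Avoidance I T
    avoid I T light with hi I <? lo T | lo I <? lo T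
    ... | yes I<T | _          = I , ⊑-refl {I} , light , inj₁ (disjointʳ {I} {T} I<T)
    ... | no _    | no loI≮loT = avoid-hi I T (≮⇒≥ loI≮loT) light
    ... | no I≮T  | yes loI<loT = [ before , after ]′ (cut (inj₁ loI<loT) loT≤hiI (lo≤hi I) light)
      where
      loT≤hiI = ≮⇒≥ I≮T

      before : Light (interval (inj₁ loI<loT)) → Avoidance I T
      before left = let I′ , (a , b) , I′<T , light′ = trimʳ (inj₁ loI<loT) left in
        I′ , (a , ≤-trans b loT≤hiI) , light′ , inj₁ (disjointʳ {I′} {T} I′<T)

      after : Light (interval loT≤hiI) → Avoidance I T
      after right =
        let I′ , (a , b) , light′ , result = avoid-hi (interval loT≤hiI) T ≤-refl right in
        I′ , (≤-trans (inj₁ loI<loT) a , b) , light′ , result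

  Rect : Set
  Rect = Interval × Interval

  area : Rect → ℝ
  area (I , J) = width I * width J

  infix 4 _∈ᴿ_ _⊑ᴿ_
  _∈ᴿ_ : ℝ × ℝ → Rect → Set
  (x , y) ∈ᴿ (I , J) = x ∈ᴵ I × y ∈ᴵ J

  _⊑ᴿ_ : Rect → Rect → Set
  (I , J) ⊑ᴿ (I′ , J′) = I ⊑ I′ × J ⊑ J′

  record Valuation (V : Rect → ℝ) : Set where
    field
      nonneg : ∀ Q → 0# ≤ V Q
      superˣ : ∀ J → Superadditive (λ I → V (I , J))
      superʸ : ∀ I → Superadditive (λ J → V (I , J))

  module _ {V : Rect → ℝ} (valuation : Valuation V) where
    open Valuation valuation

    -- No light rectangle lies inside such a `B`.
    Dominates : Rect → Set
    Dominates B = ∀ {Q} → Q ⊑ᴿ B → area Q ≤ V Q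

    LightRect : Set
    LightRect = Σ[ Q ∈ Rect ] V Q < area Q

    AvoidanceRect : LightRect → Rect → Set
    AvoidanceRect Q B = Σ[ Q′ ∈ LightRect ]
      proj₁ Q′ ⊑ᴿ proj₁ Q × (∀ {p} → p ∈ᴿ proj₁ Q′ → ¬ (p ∈ᴿ B))

    -- The horizontal side is treated first, then the vertical one with the two factors of the area
    -- exchanged. If both ended inside the sides of `B`, a light rectangle would lie in `B`, against
    -- `Dominates`.
    avoid-rect : ∀ Q B → Dominates B → AvoidanceRect Q B
    avoid-rect ((I , J) , light) (T , U) dominated = avoidˣ
      (Linear.avoid (λ I → V (I , J)) (λ I → nonneg (I , J)) (superˣ J)
        (width J) (width-nonneg J) I T light)
      where
      avoidʸ : ∀ I′ → I′ ⊑ I → I′ ⊑ T →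
        Linear.Avoidance (λ J → V (I′ , J)) (λ J → nonneg (I′ , J)) (superʸ I′)
          (width I′) (width-nonneg I′) J U →
        AvoidanceRect ((I , J) , light) (T , U)
      avoidʸ I′ I′⊑I I′⊑T (J′ , J′⊑J , light′ , inj₁ disjoint) =
        ((I′ , J′) , <-respʳ-≈ (*-comm _ _) light′) , (I′⊑I , J′⊑J) ,
        λ (_ , y∈J′) (_ , y∈U) → disjoint y∈J′ y∈U
      avoidʸ I′ I′⊑I I′⊑T (J′ , J′⊑J , light′ , inj₂ J′⊑U) =
        ⊥-elim (<⇒≱ light′ (≤-trans (inj₂ (*-comm _ _)) (dominated (I′⊑T , J′⊑U))))

      avoidˣ : Linear.Avoidance (λ I → V (I , J)) (λ I → nonneg (I , J)) (superˣ J)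
          (width J) (width-nonneg J) I T →
        AvoidanceRect ((I , J) , light) (T , U)
      avoidˣ (I′ , I′⊑I , light′ , inj₁ disjoint) =
        ((I′ , J) , light′) , (I′⊑I , ⊑-refl {J}) , λ (x∈I′ , _) (x∈T , _) → disjoint x∈I′ x∈T
      avoidˣ (I′ , I′⊑I , light′ , inj₂ I′⊑T) = avoidʸ I′ I′⊑I I′⊑T
        (Linear.avoid (λ J → V (I′ , J)) (λ J → nonneg (I′ , J)) (superʸ I′)
          (width I′) (width-nonneg I′) J U (<-respʳ-≈ (*-comm _ _) light′))

    -- Stage k + 1 avoids `B k` and the stages are nested, so a point common to all of them, found
    -- one coordinate at a time, lies in no `B k`.
    escape : (B : ℕ → Rect) → (∀ k → Dominates (B k)) → (Q : LightRect) →
      ∃[ p ] p ∈ᴿ proj₁ Q × (∀ k → ¬ (p ∈ᴿ B k))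
    escape B dominated Q = (x , y) , in-seq 0 , λ k → avoids k (in-seq (suc k))
      where
      seq : ℕ → LightRect
      seq zero    = Q
      seq (suc k) = proj₁ (avoid-rect (seq k) (B k) (dominated k))

      X Y : ℕ → Interval
      X k = proj₁ (proj₁ (seq k))
      Y k = proj₂ (proj₁ (seq k))

      avoids : ∀ k {p} → p ∈ᴿ proj₁ (seq (suc k)) → ¬ (p ∈ᴿ B k)
      avoids k = proj₂ (proj₂ (avoid-rect (seq k) (B k) (dominated k)))

      shrinks : ∀ k → proj₁ (seq (suc k)) ⊑ᴿ proj₁ (seq k)
      shrinks k = proj₁ (proj₂ (avoid-rect (seq k) (B k) (dominated k)))

      x = proj₁ (common-point X (λ k → proj₁ (shrinks k)))
      y = proj₁ (common-point Y (λ k → proj₂ (shrinks k)))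

      in-seq : ∀ k → (x , y) ∈ᴿ proj₁ (seq k)
      in-seq k = proj₂ (common-point X (λ k → proj₁ (shrinks k))) k ,
                 proj₂ (common-point Y (λ k → proj₂ (shrinks k))) k

-- Merging two sequences into one

module Interleave {A : Set} where
  -- The order is a 0, b 0, a 1, b 1, and so on. The arguments change places at each step, hence the
  -- mutual recursion of `interleave-∀ˡ` and `interleave-∀ʳ`.
  interleave : (ℕ → A) → (ℕ → A) → ℕ → A
  interleave a b zero    = a 0
  interleave a b (suc k) = interleave b (a ∘ suc) k

  interleave-∀ : ∀ (P : A → Set) {a b} → (∀ k → P (a k)) → (∀ k → P (b k)) → ∀ k → P (interleave a b k)
  interleave-∀ P Pa Pb zero    = Pa 0
  interleave-∀ P Pa Pb (suc k) = interleave-∀ P Pb (Pa ∘ suc) k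

  interleave-∀ˡ : ∀ (P : A → Set) {a b} → (∀ k → P (interleave a b k)) → ∀ k → P (a k)
  interleave-∀ʳ : ∀ (P : A → Set) {a b} → (∀ k → P (interleave a b k)) → ∀ k → P (b k)
  interleave-∀ˡ P all zero    = all 0
  interleave-∀ˡ P {a} {b} all (suc k) = interleave-∀ʳ P {b} {a ∘ suc} (all ∘ suc) k
  interleave-∀ʳ P {a} {b} all k = interleave-∀ˡ P {b} {a ∘ suc} (all ∘ suc) k

-- Total areas of covers by boxes

module Measure (R : CompleteOrderedField) where
  open OrderedField R
  open ≤-Reasoning
  open Escape R
  open Interval
  open Interleave
  open Plane R using (Box; Subset; PartialSums; CoverSums)
  open import Algebra.Properties.Monoid.Sum +-monoid using (sum)
  open import Algebra.Properties.CommutativeMonoid.Sum +-commutativeMonoid using (∑-distrib-+)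

  partialSum : ℕ → (ℕ → ℝ) → ℝ
  partialSum K a = sum {K} (λ i → a (toℕ i))

  partialSum-+ : ∀ K a b → partialSum K a + partialSum K b ≈ partialSum K (λ k → a k + b k)
  partialSum-+ K a b = ≈-sym (∑-distrib-+ {K} (λ i → a (toℕ i)) (λ i → b (toℕ i)))

  partialSum-mono : ∀ K {a b} → (∀ k → a k ≤ b k) → partialSum K a ≤ partialSum K b
  partialSum-mono zero    a≤b = ≤-refl
  partialSum-mono (suc K) a≤b = +-mono-≤ (a≤b 0) (partialSum-mono K (a≤b ∘ suc))

  partialSum-nonneg : ∀ K {a} → (∀ k → 0# ≤ a k) → 0# ≤ partialSum K a
  partialSum-nonneg zero    0≤a = ≤-refl
  partialSum-nonneg (suc K) 0≤a = +-nonneg (0≤a 0) (partialSum-nonneg K (0≤a ∘ suc))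

  partialSum-monoˡ : ∀ {J K a} → (∀ k → 0# ≤ a k) → J ℕ.≤ K → partialSum J a ≤ partialSum K a
  partialSum-monoˡ {K = K} 0≤a ℕ.z≤n       = partialSum-nonneg K 0≤a
  partialSum-monoˡ         0≤a (ℕ.s≤s J≤K) = +-monoʳ-≤ _ (partialSum-monoˡ (0≤a ∘ suc) J≤K)

  term≤partialSum : ∀ k {a} → (∀ k → 0# ≤ a k) → a k ≤ partialSum (suc k) a
  term≤partialSum zero {a} 0≤a = inj₂ (≈-sym (+-identityʳ (a 0)))
  term≤partialSum (suc k) {a} 0≤a = begin
    a (suc k)                         ≤⟨ term≤partialSum k (0≤a ∘ suc) ⟩
    partialSum (suc k) (a ∘ suc)      ≈⟨ +-identityˡ _ ⟨
    0# + partialSum (suc k) (a ∘ suc) ≤⟨ +-mono-≤ (0≤a 0) ≤-refl ⟩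
    partialSum (suc (suc k)) a        ∎

  abstract
    clamp : Interval → ℝ → ℝ
    clamp T t = lo T ⊔ (hi T ⊓ t)

    clamp-mono : ∀ T {s t} → s ≤ t → clamp T s ≤ clamp T t
    clamp-mono T s≤t = ⊔-monoʳ-≤ (lo T) (⊓-monoʳ-≤ (hi T) s≤t)

    clamp-hi : ∀ T t → clamp T t ≤ hi T
    clamp-hi T t = ⊔-lub (lo≤hi T) (x⊓y≤x (hi T) t)

    clamp-lo : ∀ T t → lo T ≤ clamp T t
    clamp-lo T t = x≤x⊔y (lo T) (hi T ⊓ t)

    clamp-inside : ∀ T {t} → lo T ≤ t → t ≤ hi T → clamp T t ≈ t
    clamp-inside T {t} lo≤t t≤hi = begin-equality
      lo T ⊔ (hi T ⊓ t)  ≈⟨ x≤y⇒x⊔y≈y (≤-trans lo≤t (inj₂ (≈-sym hi⊓t≈t))) ⟩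
      hi T ⊓ t           ≈⟨ hi⊓t≈t ⟩
      t                  ∎
      where
      hi⊓t≈t : hi T ⊓ t ≈ t
      hi⊓t≈t = x≤y⇒y⊓x≈x t≤hi

  -- The length of the intersection of `T` and `I`, zero if they are disjoint. As a difference of
  -- two values of `clamp T`, the nearest-point map onto `T`, it telescopes when `I` is cut.
  commonWidth : Interval → Interval → ℝ
  commonWidth T I = clamp T (hi I) - clamp T (lo I)

  commonWidth-nonneg : ∀ T I → 0# ≤ commonWidth T I
  commonWidth-nonneg T I = diff-nonneg (clamp-mono T (lo≤hi I))

  commonWidth≤width : ∀ T I → commonWidth T I ≤ width T
  commonWidth≤width T I = +-mono-≤ (clamp-hi T (hi I)) (-‿anti-≤ (clamp-lo T (lo I)))

  commonWidth-inside : ∀ {T I} → I ⊑ T → commonWidth T I ≈ width I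
  commonWidth-inside {T} {I} (loT≤loI , hiI≤hiT) =
    +-cong (clamp-inside T (≤-trans loT≤loI (lo≤hi I)) hiI≤hiT)
           (-‿cong (clamp-inside T loT≤loI (≤-trans (lo≤hi I) hiI≤hiT)))

  sharedArea : Rect → Rect → ℝ
  sharedArea (T , U) (I , J) = commonWidth T I * commonWidth U J

  sharedArea-nonneg : ∀ B Q → 0# ≤ sharedArea B Q
  sharedArea-nonneg (T , U) (I , J) = *-nonneg (commonWidth-nonneg T I) (commonWidth-nonneg U J)

  sharedArea≤area : ∀ B Q → sharedArea B Q ≤ area B
  sharedArea≤area (T , U) (I , J) =
    *-mono-≤ (commonWidth-nonneg T I) (width-nonneg U) (commonWidth≤width T I) (commonWidth≤width U J)

  telescopeˡ : ∀ a t b w → (t - a) * w + (b - t) * w ≈ (b - a) * w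
  telescopeˡ = solve 4 (λ a t b w → (t :- a) :* w :+ (b :- t) :* w := (b :- a) :* w) ≈-refl

  telescopeʳ : ∀ a t b w → w * (t - a) + w * (b - t) ≈ w * (b - a)
  telescopeʳ = solve 4 (λ a t b w → w :* (t :- a) :+ w :* (b :- t) := w :* (b :- a)) ≈-refl

  module Family (B : ℕ → Rect) {s : ℝ} (bound : ∀ K → partialSum K (area ∘ B) ≤ s) where

    shares : Rect → ℕ → ℝ
    shares Q k = sharedArea (B k) Q

    shares-nonneg : ∀ Q k → 0# ≤ shares Q k
    shares-nonneg Q k = sharedArea-nonneg (B k) Q

    shares≤s : ∀ Q K → partialSum K (shares Q) ≤ s
    shares≤s Q K = ≤-trans (partialSum-mono K (λ k → sharedArea≤area (B k) Q)) (bound K)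

    abstract
      totalShare-isSup : ∀ Q → ∃[ t ] IsSup (λ t → Lift (lsuc 0ℓ) (PartialSums (shares Q) t)) t
      totalShare-isSup Q = complete _ (0# , lift (0 , ≈-refl))
        (s , λ (lift (K , t≈)) → ≤-trans (inj₂ t≈) (shares≤s Q K))

      -- The sum of the series of areas of the intersections of `Q` with `B k`, whose partial sums
      -- are bounded by `s`.
      totalShare : Rect → ℝ
      totalShare Q = proj₁ (totalShare-isSup Q)

      partial≤totalShare : ∀ Q K → partialSum K (shares Q) ≤ totalShare Q
      partial≤totalShare Q K = proj₁ (proj₂ (totalShare-isSup Q)) (lift (K , ≈-refl))

      totalShare≤ : ∀ Q {u} → (∀ K → partialSum K (shares Q) ≤ u) → totalShare Q ≤ u
      totalShare≤ Q ≤u = proj₂ (proj₂ (totalShare-isSup Q)) λ (lift (K , t≈)) → ≤-trans (inj₂ t≈) (≤u K)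

    -- Partial sums of lengths J and K are at most those of length J + K, where the two series add
    -- termwise. The suprema over K and over J are then taken in turn, each time with the other term
    -- moved to the right.
    totalShare-super : ∀ {Q₁ Q₂ Q} → (∀ k → shares Q₁ k + shares Q₂ k ≈ shares Q k) →
                       totalShare Q₁ + totalShare Q₂ ≤ totalShare Q
    totalShare-super {Q₁} {Q₂} {Q} splits = transpose-+ (totalShare≤ Q₁ λ J → transpose-- (totalShare≤ Q₂ (both J)))
      where
      t  = totalShare Q
      both : ∀ J K → partialSum K (shares Q₂) ≤ t - partialSum J (shares Q₁)
      both J K = 0≤-⇒≤ (diff-nonneg (begin
        partialSum J (shares Q₁) + partialSum K (shares Q₂)
          ≤⟨ +-mono-≤ (partialSum-monoˡ {J} {J ℕ.+ K} (shares-nonneg Q₁) (ℕ.m≤m+n J K))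
                      (partialSum-monoˡ {K} {J ℕ.+ K} (shares-nonneg Q₂) (ℕ.m≤n+m K J)) ⟩
        partialSum (J ℕ.+ K) (shares Q₁) + partialSum (J ℕ.+ K) (shares Q₂)
          ≈⟨ partialSum-+ (J ℕ.+ K) (shares Q₁) (shares Q₂) ⟩
        partialSum (J ℕ.+ K) (λ k → shares Q₁ k + shares Q₂ k)
          ≤⟨ partialSum-mono (J ℕ.+ K) (λ k → inj₂ (splits k)) ⟩
        partialSum (J ℕ.+ K) (shares Q)
          ≤⟨ partial≤totalShare Q (J ℕ.+ K) ⟩
        t ∎))
        (solve 3 (λ t a b → t :- (a :+ b) := t :- a :- b) ≈-refl t _ _)
      transpose-- : ∀ {a b} → b ≤ t - a → a ≤ t - b
      transpose-- {a} {b} b≤ = 0≤-⇒≤ (diff-nonneg b≤) (solve 3 (λ t a b → t :- a :- b := t :- b :- a) ≈-refl t a b)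
      transpose-+ : ∀ {a b} → a ≤ t - b → a + b ≤ t
      transpose-+ {a} {b} a≤ = 0≤-⇒≤ (diff-nonneg a≤) (solve 3 (λ t a b → t :- b :- a := t :- (a :+ b)) ≈-refl t a b)

    shares-cutˣ : ∀ J {a t b} (a≤t : a ≤ t) (t≤b : t ≤ b) (a≤b : a ≤ b) k →
      shares (interval a≤t , J) k + shares (interval t≤b , J) k ≈ shares (interval a≤b , J) k
    shares-cutˣ J {a} {t} {b} _ _ _ k = telescopeˡ (clamp T a) (clamp T t) (clamp T b) (commonWidth U J)
      where
      T = proj₁ (B k)
      U = proj₂ (B k)

    shares-cutʸ : ∀ I {a t b} (a≤t : a ≤ t) (t≤b : t ≤ b) (a≤b : a ≤ b) k →
      shares (I , interval a≤t) k + shares (I , interval t≤b) k ≈ shares (I , interval a≤b) k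
    shares-cutʸ I {a} {t} {b} _ _ _ k = telescopeʳ (clamp U a) (clamp U t) (clamp U b) (commonWidth T I)
      where
      T = proj₁ (B k)
      U = proj₂ (B k)

    totalShare-superˣ : ∀ J → Superadditive (λ I → totalShare (I , J))
    totalShare-superˣ J a≤t t≤b a≤b =
      totalShare-super {interval a≤t , J} {interval t≤b , J} {interval a≤b , J} (shares-cutˣ J a≤t t≤b a≤b)

    totalShare-superʸ : ∀ I → Superadditive (λ J → totalShare (I , J))
    totalShare-superʸ I a≤t t≤b a≤b =
      totalShare-super {I , interval a≤t} {I , interval t≤b} {I , interval a≤b} (shares-cutʸ I a≤t t≤b a≤b)

    totalShare-valuation : Valuation totalShare
    totalShare-valuation = record
      { nonneg = λ Q → partial≤totalShare Q 0
      ; superˣ = totalShare-superˣ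
      ; superʸ = totalShare-superʸ
      }

    -- The summand for `B k` alone is already the area of `Q`.
    area≤totalShare : ∀ k {Q} → Q ⊑ᴿ B k → area Q ≤ totalShare Q
    area≤totalShare k {Q} (I⊑ , J⊑) = begin
      area Q                         ≈⟨ *-cong (commonWidth-inside {proj₁ (B k)} {proj₁ Q} I⊑) (commonWidth-inside {proj₂ (B k)} {proj₂ Q} J⊑) ⟨
      shares Q k                     ≤⟨ term≤partialSum k (shares-nonneg Q) ⟩
      partialSum (suc k) (shares Q)  ≤⟨ partial≤totalShare Q (suc k) ⟩
      totalShare Q                   ∎

  -- Reflection of rectangles under y ↦ n - y

  module Reflection (n : ℝ) where
    mirrorᴵ : Interval → Interval
    mirrorᴵ J = interval (+-monoʳ-≤ n (-‿anti-≤ (lo≤hi J)))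

    mirror : Rect → Rect
    mirror (I , J) = I , mirrorᴵ J

    width-mirror : ∀ J → width (mirrorᴵ J) ≈ width J
    width-mirror J = solve 3 (λ n a b → n :- a :- (n :- b) := b :- a) ≈-refl n (lo J) (hi J)

    mirror-swap-≤ : ∀ {a b} → n - a ≤ b → n - b ≤ a
    mirror-swap-≤ {a} {b} n-a≤b = 0≤-⇒≤ (diff-nonneg n-a≤b)
      (solve 3 (λ n a b → b :- (n :- a) := a :- (n :- b)) ≈-refl n a b)

    mirror-swap-≥ : ∀ {a b} → b ≤ n - a → a ≤ n - b
    mirror-swap-≥ {a} {b} b≤n-a = 0≤-⇒≤ (diff-nonneg b≤n-a)
      (solve 3 (λ n a b → n :- a :- b := n :- b :- a) ≈-refl n a b)

    mirror-∈ : ∀ {x y} B → (x , n - y) ∈ᴿ B → (x , y) ∈ᴿ mirror B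
    mirror-∈ _ (x∈I , a≤ , ≤b) = x∈I , mirror-swap-≤ ≤b , mirror-swap-≥ a≤

    mirror-⊑ : ∀ {Q B} → Q ⊑ᴿ mirror B → mirror Q ⊑ᴿ B
    mirror-⊑ (I⊑ , b≤ , ≤a) = I⊑ , mirror-swap-≥ ≤a , mirror-swap-≤ b≤

    -- For `totalShare` this is the share of the boxes together with their mirror images: reflecting
    -- `Q` instead of the boxes leaves the shared areas unchanged.
    symmetrised : (Rect → ℝ) → Rect → ℝ
    symmetrised V Q = V Q + V (mirror Q)

    symmetrised-valuation : ∀ {V} → Valuation V → Valuation (symmetrised V)
    symmetrised-valuation {V} valuation = record
      { nonneg = λ Q → +-nonneg (nonneg Q) (nonneg (mirror Q))
      ; superˣ = λ J a≤t t≤b a≤b → regroup (superˣ J a≤t t≤b a≤b) (superˣ (mirrorᴵ J) a≤t t≤b a≤b)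
      ; superʸ = λ I a≤t t≤b a≤b → regroup (superʸ I a≤t t≤b a≤b)
          -- Reflection exchanges the lower and the upper piece.
          (≤-trans (inj₂ (+-comm _ _))
            (superʸ I (+-monoʳ-≤ n (-‿anti-≤ t≤b)) (+-monoʳ-≤ n (-‿anti-≤ a≤t)) (+-monoʳ-≤ n (-‿anti-≤ a≤b))))
      }
      where
      open Valuation valuation
      regroup : ∀ {a b c d e f} → a + b ≤ e → c + d ≤ f → (a + c) + (b + d) ≤ e + f
      regroup {a} {b} {c} {d} ab cd = ≤-trans
        (inj₂ (solve 4 (λ a b c d → (a :+ c) :+ (b :+ d) := (a :+ b) :+ (c :+ d)) ≈-refl a b c d))
        (+-mono-≤ ab cd)

  Degenerate : Rect → Set
  Degenerate (I , J) = width I ≤ 0# ⊎ width J ≤ 0#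

  width-mono : ∀ {I T} → I ⊑ T → width I ≤ width T
  width-mono (a , b) = +-mono-≤ b (-‿anti-≤ a)

  degenerate-dominated : ∀ {V} (valuation : Valuation V) {B} → Degenerate B → Dominates valuation B
  degenerate-dominated {V} valuation {T , U} degenerate {I , J} (I⊑T , J⊑U) =
    ≤-trans (bound degenerate) (Valuation.nonneg valuation (I , J))
    where
    bound : Degenerate (T , U) → width I * width J ≤ 0#
    bound (inj₁ T≤0) = ≤-trans (*-monoˡ-≤ (width-nonneg J) (≤-trans (width-mono {I} {T} I⊑T) T≤0)) (inj₂ (zeroˡ _))
    bound (inj₂ U≤0) = ≤-trans (inj₂ (*-comm _ _))
      (≤-trans (*-monoˡ-≤ (width-nonneg I) (≤-trans (width-mono {J} {U} J⊑U) U≤0)) (inj₂ (zeroˡ _)))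

  boxRect : Box → Rect
  boxRect B = interval (Box.x₀≤x₁ B) , interval (Box.y₀≤y₁ B)

  -- If `V □` fell short of n², `escape` would yield a point of the square outside all boxes, their
  -- mirror images and the segments `L`, contrary to the hypothesis on `S`. So n² ≤ `V □`, which is
  -- a sum of two total shares, each at most `s`.
  half-area≤cover : ∀ (S : Subset) {n} (0≤n : 0# ≤ n) (L : ℕ → Rect) → (∀ k → Degenerate (L k)) →
    (∀ {x y} → (x , y) ∈ᴿ (interval 0≤n , interval 0≤n) → (∀ k → ¬ ((x , y) ∈ᴿ L k)) →
      (x , y) ∈ S ⊎ (x , n - y) ∈ S) →
    LowerBound (CoverSums S) (½ * (n * n))
  half-area≤cover S {n} 0≤n L L-degenerate S∪mirrorS {s} (boxes , covers , upper , _) =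
    halve-≤ (≤-trans (≮⇒≥ not-light) (+-mono-≤ (totalShare≤ □ (shares≤s □)) (totalShare≤ (mirror □) (shares≤s (mirror □)))))
    where
    open Reflection n
    B : ℕ → Rect
    B = boxRect ∘ boxes
    open Family B {s} (λ K → upper (K , ≈-refl))
    □ : Rect
    □ = interval 0≤n , interval 0≤n
    V = symmetrised totalShare
    valuation = symmetrised-valuation totalShare-valuation
    A = interleave (interleave B (mirror ∘ B)) L

    B-dominated : ∀ k → Dominates valuation (B k)
    B-dominated k {Q} Q⊑B = begin
      area Q                ≈⟨ +-identityʳ _ ⟨
      area Q + 0#           ≤⟨ +-mono-≤ (area≤totalShare k {Q} Q⊑B) (Valuation.nonneg totalShare-valuation (mirror Q)) ⟩
      V Q                   ∎

    mirrorB-dominated : ∀ k → Dominates valuation (mirror (B k))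
    mirrorB-dominated k {Q} Q⊑ = begin
      area Q                ≈⟨ *-congˡ (width-mirror (proj₂ Q)) ⟨
      area (mirror Q)       ≈⟨ +-identityˡ _ ⟨
      0# + area (mirror Q)  ≤⟨ +-mono-≤ (Valuation.nonneg totalShare-valuation Q) (area≤totalShare k {mirror Q} (mirror-⊑ {Q} {B k} Q⊑)) ⟩
      V Q                   ∎

    A-dominated : ∀ k → Dominates valuation (A k)
    A-dominated = interleave-∀ (λ Q → Dominates valuation Q)
      (interleave-∀ (λ Q → Dominates valuation Q) B-dominated mirrorB-dominated)
      (λ k → degenerate-dominated valuation {L k} (L-degenerate k))

    uncovered : ∀ {p} → p ∈ᴿ □ → ¬ (∀ k → ¬ (p ∈ᴿ A k))
    uncovered {p} p∈□ p∉A =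
      [ (λ p∈S → let k , p∈B = covers p∈S in
          interleave-∀ˡ Avoids {B} {mirror ∘ B} p∉boxes k p∈B)
      , (λ p∈S → let k , p∈B = covers p∈S in
          interleave-∀ʳ Avoids {B} {mirror ∘ B} p∉boxes k (mirror-∈ (B k) p∈B))
      ]′ (S∪mirrorS p∈□ (interleave-∀ʳ Avoids {interleave B (mirror ∘ B)} {L} p∉A))
      where
      Avoids : Rect → Set
      Avoids Q = ¬ (p ∈ᴿ Q)

      p∉boxes : ∀ k → Avoids (interleave B (mirror ∘ B) k)
      p∉boxes = interleave-∀ˡ Avoids {interleave B (mirror ∘ B)} {L} p∉A

    not-light : ¬ (V □ < n * n)
    not-light V<nn =
      let p , p∈□ , p∉A = escape valuation A A-dominated (□ , <-respʳ-≈ nn≈area V<nn) in uncovered p∈□ p∉A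
      where
      nn≈area : n * n ≈ area □
      nn≈area = solve 1 (λ n → n :* n := (n :- con (+ 0)) :* (n :- con (+ 0))) ≈-refl n

-- Splitting a list by a predicate

length-filter-¬ : ∀ {A : Set} {P : A → Set} (P? : Decidable P) xs →
  length (filter P? xs) ℕ.+ length (filter (¬? ∘ P?) xs) ≡ length xs
length-filter-¬ P? [] = ≡.refl
length-filter-¬ P? (x ∷ xs) with P? x
... | yes _ = ≡.cong suc (length-filter-¬ P? xs)
... | no  _ = ≡.trans (ℕ.+-suc _ _) (≡.cong suc (length-filter-¬ P? xs))

*-≤-2*-split : ∀ a b {l k n} → a ℕ.+ b ≡ l → a ℕ.* k ℕ.≤ n → b ℕ.* k ℕ.≤ n → l ℕ.* k ℕ.≤ 2 ℕ.* n
*-≤-2*-split a b {k = k} {n} ≡.refl ak≤n bk≤n = ℕ.≤-trans (ℕ.≤-reflexive (ℕ.*-distribʳ-+ k a b))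
  (ℕ.+-mono-≤ ak≤n (ℕ.≤-trans bk≤n (ℕ.m≤m+n n 0)))

-- Open subsets of the plane

module OpenSets (R : CompleteOrderedField) where
  open OrderedField R
  open ≤-Reasoning
  open Plane R using (Subset; IsOpen)

  IsOpen-resp-≈ : ∀ {S} → IsOpen S → ∀ {x y x′ y′} → x ≈ x′ → y ≈ y′ → (x , y) ∈ S → (x′ , y′) ∈ S
  IsOpen-resp-≈ openS {x} {y} {x′} {y′} x≈x′ y≈y′ p∈S =
    let r , 0<r , ball = openS p∈S in ball (begin-strict
      (x′ - x) * (x′ - x) + (y′ - y) * (y′ - y)  ≈⟨ +-cong (*-cong (same x≈x′) (same x≈x′)) (*-cong (same y≈y′) (same y≈y′)) ⟩
      0# * 0# + 0# * 0#                          ≈⟨ +-cong (zeroˡ 0#) (zeroˡ 0#) ⟩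
      0# + 0#                                    ≈⟨ +-identityˡ 0# ⟩
      0#                                         <⟨ *-pos 0<r 0<r ⟩
      r * r                                      ∎)
    where
    same : ∀ {a b} → a ≈ b → b - a ≈ 0#
    same {a} {b} a≈b = ≈-trans (+-congʳ (≈-sym a≈b)) (-‿inverseʳ a)

  ∅-open : IsOpen ∅
  ∅-open ()

  ∪-open : ∀ {S T} → IsOpen S → IsOpen T → IsOpen (S ∪ T)
  ∪-open openS openT (inj₁ p∈S) = let r , 0<r , ball = openS p∈S in r , 0<r , λ d → inj₁ (ball d)
  ∪-open openS openT (inj₂ p∈T) = let r , 0<r , ball = openT p∈T in r , 0<r , λ d → inj₂ (ball d)

  ⊓-pos : ∀ {x y} → 0# < x → 0# < y → 0# < x ⊓ y
  ⊓-pos {x} {y} 0<x 0<y with ⊓-sel x y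
  ... | inj₁ eq = <-respʳ-≈ (≈-sym eq) 0<x
  ... | inj₂ eq = <-respʳ-≈ (≈-sym eq) 0<y

  ∩-open : ∀ {S T} → IsOpen S → IsOpen T → IsOpen (S ∩ T)
  ∩-open openS openT (p∈S , p∈T) =
    let r , 0<r , ballS = openS p∈S
        q , 0<q , ballT = openT p∈T
        0<m = ⊓-pos 0<r 0<q
        mm≤rr = *-mono-≤ (inj₁ 0<m) (inj₁ 0<r) (x⊓y≤x r q) (x⊓y≤x r q)
        mm≤qq = *-mono-≤ (inj₁ 0<m) (inj₁ 0<q) (x⊓y≤y r q) (x⊓y≤y r q)
    in r ⊓ q , 0<m , λ d → ballS (<-≤-trans d mm≤rr) , ballT (<-≤-trans d mm≤qq)

  translate : ℝ → Subset → Subset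
  translate c S (x , y) = (x , y - c) ∈ S

  translate-open : ∀ c {S} → IsOpen S → IsOpen (translate c S)
  translate-open c openS {x} {y} p∈S = let r , 0<r , ball = openS p∈S in
    r , 0<r , λ {x′} {y′} d → ball (≤-<-trans (inj₂ (same-distance x y x′ y′)) d)
    where
    same-distance : ∀ x y x′ y′ →
      (x′ - x) * (x′ - x) + ((y′ - c) - (y - c)) * ((y′ - c) - (y - c)) ≈
      (x′ - x) * (x′ - x) + (y′ - y) * (y′ - y)
    same-distance x y x′ y′ = +-congˡ (*-cong (cancel y y′) (cancel y y′))
      where
      cancel : ∀ y y′ → (y′ - c) - (y - c) ≈ y′ - y
      cancel = solve 3 (λ c y y′ → (y′ :- c) :- (y :- c) := y′ :- y) ≈-refl c

  abs<radius : ∀ {d e r} → 0# < r → d * d + e * e < r * r → d < r × - d < r × e < r × - e < r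
  abs<radius {d} {e} {r} 0<r dd+ee<rr =
    root dd<rr , root (≤-<-trans (inj₂ (neg-sq d)) dd<rr) , root ee<rr , root (≤-<-trans (inj₂ (neg-sq e)) ee<rr)
    where
    root : ∀ {a} → a * a < r * r → a < r
    root = sq-cancel-< (inj₁ 0<r)
    neg-sq : ∀ a → (- a) * (- a) ≈ a * a
    neg-sq = solve 1 (λ a → (:- a) :* (:- a) := a :* a) ≈-refl
    dd<rr : d * d < r * r
    dd<rr = ≤-<-trans (≤-trans (inj₂ (≈-sym (+-identityʳ (d * d)))) (+-monoʳ-≤ (d * d) (0≤x*x e))) dd+ee<rr
    ee<rr : e * e < r * r
    ee<rr = ≤-<-trans (≤-trans (inj₂ (≈-sym (+-identityˡ (e * e)))) (+-mono-≤ (0≤x*x d) ≤-refl)) dd+ee<rr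

  above : ∀ {a x x′} → - (x′ - x) < x - a → a < x′
  above {a} {x} {x′} lt = 0<-⇒< (<⇒0<- lt)
    (solve 3 (λ a x x′ → (x :- a) :- :- (x′ :- x) := x′ :- a) ≈-refl a x x′)

  below : ∀ {b x x′} → x′ - x < b - x → x′ < b
  below {b} {x} {x′} lt = 0<-⇒< (<⇒0<- lt)
    (solve 3 (λ b x x′ → (b :- x) :- (x′ :- x) := b :- x′) ≈-refl b x x′)

  OpenRect : ℝ → ℝ → ℝ → ℝ → Subset
  OpenRect a b c d (x , y) = (a < x × x < b) × (c < y × y < d)

  openRect-open : ∀ {a b c d} → IsOpen (OpenRect a b c d)
  openRect-open {a} {b} {c} {d} =
    ∩-open {λ (x , y) → a < x × x < b} {λ (x , y) → c < y × y < d}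
      (∩-open {λ (x , y) → a < x} {λ (x , y) → x < b}
        (λ {x} a<x → x - a , <⇒0<- a<x , λ δ → above (proj₁ (proj₂ (abs<radius (<⇒0<- a<x) δ))))
        (λ {x} x<b → b - x , <⇒0<- x<b , λ δ → below (proj₁ (abs<radius (<⇒0<- x<b) δ))))
      (∩-open {λ (x , y) → c < y} {λ (x , y) → y < d}
        (λ {x} {y} c<y → y - c , <⇒0<- c<y , λ δ → above (proj₂ (proj₂ (proj₂ (abs<radius (<⇒0<- c<y) δ)))))
        (λ {x} {y} y<d → d - y , <⇒0<- y<d , λ δ → below (proj₁ (proj₂ (proj₂ (abs<radius (<⇒0<- y<d) δ))))))

-- The Rademacher set: its mirror image and the grids inside it

module Rademacher (R : CompleteOrderedField) where
  open OrderedField R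
  open ≤-Reasoning
  open Plane R using (Subset; IsOpen)
  open OpenSets R

  module Digits (h δ : ℝ) (0<h : 0# < h) (0<δ : 0# < δ) where
    w : ℕ → ℝ
    w m = (2 ℕ.^ m) · δ

    w-suc : ∀ m → w (suc m) ≈ w m + w m
    w-suc m = ≈-trans (×-homo-+ δ (2 ℕ.^ m) (2 ℕ.^ m ℕ.+ 0))
      (+-congˡ (×-congˡ (ℕ.+-identityʳ (2 ℕ.^ m))))

    -- In units of h and δ: y has 1 as its binary digit number ⌊x⌋,
    -- counted from the least significant one.
    S : ℕ → Subset
    S zero    = ∅
    S (suc m) = OpenRect (m · h) (suc m · h) (w m) (w (suc m)) ∪ (S m ∪ translate (w m) (S m))

    S-open : ∀ m → IsOpen (S m)
    S-open zero    = ∅-open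
    S-open (suc m) = ∪-open {OpenRect (m · h) (suc m · h) (w m) (w (suc m))} {S m ∪ translate (w m) (S m)} openRect-open
      (∪-open {S m} {translate (w m) (S m)} (S-open m) (translate-open (w m) {S m} (S-open m)))

    S-resp-≈ : ∀ m {x y x′ y′} → x ≈ x′ → y ≈ y′ → (x , y) ∈ S m → (x′ , y′) ∈ S m
    S-resp-≈ m = IsOpen-resp-≈ {S m} (S-open m)

    0≤w : ∀ m → 0# ≤ w m
    0≤w m = ·-nonneg (2 ℕ.^ m) (inj₁ 0<δ)

    w≤w-suc : ∀ m → w m ≤ w (suc m)
    w≤w-suc m = ·-monoˡ-≤ (inj₁ 0<δ) (ℕ.m≤m+n (2 ℕ.^ m) _)

    -- Reflection at height `w (suc m)` followed by lowering by `w m` is reflection at height `w m`;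
    -- this places a mirror image found in `S m` in the upper copy of `S m`.
    w-doubling : ∀ m y → w (suc m) - y - w m ≈ w m - y
    w-doubling m y = ≈-trans (+-congʳ (+-congʳ (w-suc m)))
      (solve 2 (λ a y → a :+ a :- y :- a := a :- y) ≈-refl (w m) y)

    0<-⇒<′ : ∀ {a y} → 0# < y - a → a < y
    0<-⇒<′ 0<y-a = 0<-⇒< 0<y-a ≈-refl

    -⇒+-< : ∀ {a b y} → y - b < a → y < a + b
    -⇒+-< {a} {b} {y} lt = 0<-⇒< (<⇒0<- lt)
      (solve 3 (λ a b y → a :- (y :- b) := a :+ b :- y) ≈-refl a b y)

    S-bounds : ∀ m {x y} → (x , y) ∈ S m → (0# < x × x < m · h) × (0# < y × y < w m)
    S-bounds (suc m) (inj₁ ((a , b) , (c , d))) =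
      (≤-<-trans (·-nonneg m (inj₁ 0<h)) a , b) , (≤-<-trans (0≤w m) c , d)
    S-bounds (suc m) (inj₂ (inj₁ p)) =
      let (a , b) , (c , d) = S-bounds m p in
      (a , <-≤-trans b (·-monoˡ-≤ (inj₁ 0<h) (ℕ.n≤1+n m))) , (c , <-≤-trans d (w≤w-suc m))
    S-bounds (suc m) (inj₂ (inj₂ p)) =
      let (a , b) , (c , d) = S-bounds m p in
      (a , <-≤-trans b (·-monoˡ-≤ (inj₁ 0<h) (ℕ.n≤1+n m))) ,
      (≤-<-trans (0≤w m) (0<-⇒<′ c) , <-respʳ-≈ (≈-sym (w-suc m)) (-⇒+-< d))

    ≤∧≉⇒< : ∀ {a b} → a ≤ b → a ≉ b → a < b
    ≤∧≉⇒< (inj₁ a<b) _   = a<b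
    ≤∧≉⇒< (inj₂ a≈b) a≉b = ⊥-elim (a≉b a≈b)

    -- In the last strip the set is the upper half, which reflection exchanges with the lower half.
    -- Over the earlier strips both halves are copies of `S m`, and reflection exchanges the copies
    -- while reflecting each. Excluding the grid lines excludes the sides of the open rectangles.
    mirror-cover : ∀ m {x y} → 0# ≤ x → x ≤ m · h → 0# ≤ y → y ≤ w m →
      (∀ i → x ≉ i · h) → (∀ j → y ≉ j · δ) → (x , y) ∈ S m ⊎ (x , w m - y) ∈ S m
    mirror-cover zero 0≤x x≤0 _ _ x≉ _ = ⊥-elim (<⇒≱ (≤∧≉⇒< x≤0 (x≉ 0)) 0≤x)
    mirror-cover (suc m) {x} {y} 0≤x x≤ 0≤y y≤ x≉ y≉ with compare x (m · h) | compare y (w m)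
    ... | tri≈ _ x≈ _ | _ = ⊥-elim (x≉ m x≈)
    ... | _ | tri≈ _ y≈ _ = ⊥-elim (y≉ (2 ℕ.^ m) y≈)
    ... | tri> _ _ mh<x | tri> _ _ w<y =
      inj₁ (inj₁ ((mh<x , ≤∧≉⇒< x≤ (x≉ (suc m))) , (w<y , ≤∧≉⇒< y≤ (y≉ (2 ℕ.^ suc m)))))
    ... | tri> _ _ mh<x | tri< y<w _ _ =
      inj₂ (inj₁ ((mh<x , ≤∧≉⇒< x≤ (x≉ (suc m))) ,
        (0<-⇒< (<⇒0<- y<w) (≈-sym (w-doubling m y)) ,
         0<-⇒< (≤∧≉⇒< 0≤y (λ 0≈y → y≉ 0 (≈-sym 0≈y))) (solve 2 (λ a y → y := a :- (a :- y)) ≈-refl (w (suc m)) y))))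
    ... | tri< x<mh _ _ | tri< y<w _ _
      with mirror-cover m 0≤x (inj₁ x<mh) 0≤y (inj₁ y<w) x≉ y≉
    ...   | inj₁ p = inj₁ (inj₂ (inj₁ p))
    ...   | inj₂ q = inj₂ (inj₂ (inj₂ (S-resp-≈ m ≈-refl (≈-sym (w-doubling m y)) q)))
    -- Here y is in the upper half and is lowered by `w m` for the recursive call; as `w m` is a
    -- multiple of `δ`, it stays off the grid lines.
    mirror-cover (suc m) {x} {y} 0≤x x≤ 0≤y y≤ x≉ y≉ | tri< x<mh _ _ | tri> _ _ w<y
      with mirror-cover m 0≤x (inj₁ x<mh) (diff-nonneg (inj₁ w<y))
             (0≤-⇒≤ (diff-nonneg y≤) (≈-trans (+-congʳ (w-suc m)) (solve 2 (λ a y → a :+ a :- y := a :- (y :- a)) ≈-refl (w m) y)))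
             x≉ (λ j y-w≈ → y≉ (2 ℕ.^ m ℕ.+ j) (shifted j y-w≈))
      where
      shifted : ∀ j → y - w m ≈ j · δ → y ≈ (2 ℕ.^ m ℕ.+ j) · δ
      shifted j y-w≈ = begin-equality
        y                         ≈⟨ solve 2 (λ a y → y := a :+ (y :- a)) ≈-refl (w m) y ⟩
        w m + (y - w m)           ≈⟨ +-congˡ y-w≈ ⟩
        w m + j · δ               ≈⟨ ×-homo-+ δ (2 ℕ.^ m) j ⟨
        (2 ℕ.^ m ℕ.+ j) · δ       ∎
    ...   | inj₁ p = inj₁ (inj₂ (inj₂ p))
    ...   | inj₂ q = inj₂ (inj₂ (inj₁ (S-resp-≈ m ≈-refl
      (≈-trans (solve 2 (λ a y → a :- (y :- a) := a :+ a :- y) ≈-refl (w m) y) (+-congʳ (≈-sym (w-suc m)))) q)))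

    -- The list descends, so among the columns only the head can lie in the last strip.
    Spaced : ℝ → List ℝ → Set
    Spaced g = AllPairs (λ a b → b + g ≤ a)

    -- Each column halves the number of admissible rows, initially 2^m. The product form also covers
    -- more than m columns, where it forces `zs` to be empty. With `us` empty, the range condition
    -- is what confines the rows.
    Sparse : ℕ → Set
    Sparse m = ∀ us zs → Spaced h us → Spaced δ zs → (∀ {z} → z ∈ˡ zs → 0# ≤ z × z < w m) →
      (∀ {u z} → u ∈ˡ us → z ∈ˡ zs → (u , z) ∈ S m) → length zs ℕ.* 2 ℕ.^ length us ℕ.≤ 2 ℕ.^ m

    old-strip-lower : ∀ m {u z} → u < m · h → z < w m → (u , z) ∈ S (suc m) → (u , z) ∈ S m
    old-strip-lower m u<mh z<w (inj₁ ((mh<u , _) , _)) = ⊥-elim (asym u<mh mh<u)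
    old-strip-lower m u<mh z<w (inj₂ (inj₁ p)) = p
    old-strip-lower m u<mh z<w (inj₂ (inj₂ p)) = ⊥-elim (asym z<w (0<-⇒<′ (proj₁ (proj₂ (S-bounds m p)))))

    old-strip-upper : ∀ m {u z} → u < m · h → w m ≤ z → (u , z) ∈ S (suc m) → (u , z - w m) ∈ S m
    old-strip-upper m u<mh w≤z (inj₁ ((mh<u , _) , _)) = ⊥-elim (asym u<mh mh<u)
    old-strip-upper m u<mh w≤z (inj₂ (inj₁ p)) = ⊥-elim (<⇒≱ (proj₂ (proj₂ (S-bounds m p))) w≤z)
    old-strip-upper m u<mh w≤z (inj₂ (inj₂ p)) = p

    new-strip : ∀ m {u z} → m · h ≤ u → (u , z) ∈ S (suc m) → u < suc m · h × w m < z
    new-strip m mh≤u (inj₁ ((_ , u<) , (w<z , _))) = u< , w<z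
    new-strip m mh≤u (inj₂ (inj₁ p)) = ⊥-elim (<⇒≱ (proj₂ (proj₁ (S-bounds m p))) mh≤u)
    new-strip m mh≤u (inj₂ (inj₂ p)) = ⊥-elim (<⇒≱ (proj₂ (proj₁ (S-bounds m p))) mh≤u)

    spaced-shift : ∀ {g c zs} → Spaced g zs → Spaced g (map (_- c) zs)
    spaced-shift {g} {c} = AllPairs.map⁺ ∘ AllPairs.map λ {a} {b} b+g≤a → 0≤-⇒≤ (diff-nonneg b+g≤a)
      (solve 4 (λ a b g c → a :- (b :+ g) := a :- c :- (b :- c :+ g)) ≈-refl a b g c)

    -- Over the earlier strips the upper half of `S (suc m)` is `S m` raised by `w m`, so the bound
    -- for `S m` applies to the lowered rows.
    upper-half : ∀ m us zs → Sparse m → Spaced h us → Spaced δ zs →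
      (∀ {z} → z ∈ˡ zs → w m ≤ z × z < w (suc m)) → (∀ {u} → u ∈ˡ us → u < m · h) →
      (∀ {u z} → u ∈ˡ us → z ∈ˡ zs → (u , z) ∈ S (suc m)) → length zs ℕ.* 2 ℕ.^ length us ℕ.≤ 2 ℕ.^ m
    upper-half m us zs sparse us-spaced zs-spaced zs-range us-range rect =
      ≡.subst (λ l → l ℕ.* 2 ℕ.^ length us ℕ.≤ 2 ℕ.^ m) (length-map (_- w m) zs)
        (sparse us (map (_- w m) zs) us-spaced (spaced-shift zs-spaced) range rect′)
      where
      range : ∀ {z} → z ∈ˡ map (_- w m) zs → 0# ≤ z × z < w m
      range z∈ with ∈-map⁻ (_- w m) z∈
      ... | z , z∈zs , ≡.refl = diff-nonneg (proj₁ (zs-range z∈zs)) ,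
        0<-⇒< (<⇒0<- (proj₂ (zs-range z∈zs)))
          (≈-trans (+-congʳ (w-suc m)) (solve 2 (λ a z → a :+ a :- z := a :- (z :- a)) ≈-refl (w m) z))
      rect′ : ∀ {u z} → u ∈ˡ us → z ∈ˡ map (_- w m) zs → (u , z) ∈ S m
      rect′ u∈ z∈ with ∈-map⁻ (_- w m) z∈
      ... | z , z∈zs , ≡.refl = old-strip-upper m (us-range u∈) (proj₁ (zs-range z∈zs)) (rect u∈ z∈zs)

    -- The rows below `w m` and the remaining ones each obey the bound for `S m`, whence the factor
    -- 2.
    both-halves : ∀ m us zs → Sparse m → Spaced h us → Spaced δ zs →
      (∀ {z} → z ∈ˡ zs → 0# ≤ z × z < w (suc m)) → (∀ {u} → u ∈ˡ us → u < m · h) →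
      (∀ {u z} → u ∈ˡ us → z ∈ˡ zs → (u , z) ∈ S (suc m)) → length zs ℕ.* 2 ℕ.^ length us ℕ.≤ 2 ℕ.^ suc m
    both-halves m us zs sparse us-spaced zs-spaced zs-range us-range rect = 
      *-≤-2*-split (length ls) (length rs) (length-filter-¬ (_<? w m) zs) lower upper
      where
      ls = filter (_<? w m) zs
      rs = filter (¬? ∘ (_<? w m)) zs
      lower : length ls ℕ.* 2 ℕ.^ length us ℕ.≤ 2 ℕ.^ m
      lower = sparse us ls us-spaced (AllPairs.filter⁺ (_<? w m) zs-spaced)
        (λ z∈ → let z∈zs , z<w = ∈-filter⁻ (_<? w m) {xs = zs} z∈ in proj₁ (zs-range z∈zs) , z<w)
        (λ u∈ z∈ → let z∈zs , z<w = ∈-filter⁻ (_<? w m) {xs = zs} z∈ in old-strip-lower m (us-range u∈) z<w (rect u∈ z∈zs))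
      upper : length rs ℕ.* 2 ℕ.^ length us ℕ.≤ 2 ℕ.^ m
      upper = upper-half m us rs sparse us-spaced (AllPairs.filter⁺ (¬? ∘ (_<? w m)) zs-spaced)
        (λ z∈ → let z∈zs , z≮w = ∈-filter⁻ (¬? ∘ (_<? w m)) {xs = zs} z∈ in ≮⇒≥ z≮w , proj₂ (zs-range z∈zs))
        us-range
        (λ u∈ z∈ → rect u∈ (proj₁ (∈-filter⁻ (¬? ∘ (_<? w m)) {xs = zs} z∈)))

    -- If the head `u` is in the last strip, all rows are in the upper half and the other columns,
    -- at least `h` to the left, are in earlier strips; dropping `u` pays for the factor 2.
    -- Otherwise all columns are in earlier strips and `both-halves` applies. At m = 0, two rows
    -- with gap `δ` do not fit into [0, δ).
    sparse : ∀ m → Sparse m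
    sparse zero []       []       _ _ _ _ = ℕ.z≤n
    sparse zero []       (_ ∷ []) _ _ _ _ = ℕ.≤-refl
    sparse zero []       (z₁ ∷ z₂ ∷ _) _ ((z₂+δ≤z₁ ∷ _) ∷ _) range _ = ⊥-elim (<⇒≱ (proj₂ (range (here ≡.refl))) (begin
      w 0       ≈⟨ ≈-trans (×-homo-1 δ) (≈-sym (+-identityˡ δ)) ⟩
      0# + δ    ≤⟨ +-mono-≤ (proj₁ (range (there (here ≡.refl)))) ≤-refl ⟩
      z₂ + δ    ≤⟨ z₂+δ≤z₁ ⟩
      z₁        ∎))
    sparse zero (_ ∷ _)  []       _ _ _ _ = ℕ.z≤n
    sparse zero (_ ∷ _)  (_ ∷ _)  _ _ _ rect = ⊥-elim (rect (here ≡.refl) (here ≡.refl))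
    sparse (suc m) [] zs us-spaced zs-spaced range rect =
      both-halves m [] zs (sparse m) us-spaced zs-spaced range (λ ()) rect
    sparse (suc m) (u ∷ us) zs (u-spaced ∷ us-spaced) zs-spaced range rect with u <? m · h
    ... | yes u<mh = both-halves m (u ∷ us) zs (sparse m) (u-spaced ∷ us-spaced) zs-spaced range us<mh rect
      where
      us<mh : ∀ {u′} → u′ ∈ˡ u ∷ us → u′ < m · h
      us<mh (here ≡.refl) = u<mh
      us<mh {u′} (there u′∈) = begin-strict
        u′       ≈⟨ +-identityʳ u′ ⟨
        u′ + 0#  <⟨ +-monoʳ-< u′ 0<h ⟩
        u′ + h   ≤⟨ All.lookup u-spaced u′∈ ⟩
        u        <⟨ u<mh ⟩
        m · h    ∎
    ... | no u≮mh = ℕ.≤-trans (ℕ.≤-reflexive regroup) (ℕ.*-monoʳ-≤ 2 (count zs ≡.refl))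
      where
      in-strip : ∀ {z} → z ∈ˡ zs → u < suc m · h × w m < z
      in-strip z∈ = new-strip m (≮⇒≥ u≮mh) (rect (here ≡.refl) z∈)
      regroup : length zs ℕ.* (2 ℕ.* 2 ℕ.^ length us) ≡ 2 ℕ.* (length zs ℕ.* 2 ℕ.^ length us)
      regroup = x∙yz≈y∙xz (length zs) 2 (2 ℕ.^ length us)
        where open import Algebra.Properties.CommutativeSemigroup ℕ.*-commutativeSemigroup using (x∙yz≈y∙xz)
      -- A row is needed to see that `u` is below `suc m · h`; without rows the bound is trivial.
      count : ∀ zs′ → zs′ ≡ zs → length zs ℕ.* 2 ℕ.^ length us ℕ.≤ 2 ℕ.^ m
      count []       ≡.refl = ℕ.z≤n
      count (z ∷ _)  ≡.refl = upper-half m us zs (sparse m) us-spaced zs-spaced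
        (λ z∈ → inj₁ (proj₂ (in-strip z∈)) , proj₂ (range z∈))
        (λ {u′} u′∈ → 0<-⇒< (<⇒0<- (≤-<-trans (All.lookup u-spaced u′∈) (proj₁ (in-strip (here ≡.refl)))))
          (solve 3 (λ h mh u′ → h :+ mh :- (u′ :+ h) := mh :- u′) ≈-refl h (m · h) u′))
        (λ u′∈ z∈ → rect (there u′∈) z∈)

k<2^k : ∀ k → k ℕ.< 2 ℕ.^ k
k<2^k zero    = ℕ.≤-refl
k<2^k (suc k) = ℕ.+-mono-≤ (ℕ.≤-trans (ℕ.s≤s ℕ.z≤n) (k<2^k k)) (ℕ.≤-trans (k<2^k k) (ℕ.m≤m+n (2 ℕ.^ k) 0))

-- Grids in an open set and the two bounds for `opx`

module Final (R : CompleteOrderedField) where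
  open OrderedField R
  open ≤-Reasoning
  open Plane R using (ℝ⁺; Subset; IsOpen; xCoords; yCoords; subsetoid; Expanding; _Contains_; _IsFreeOf_; module Box;
    square; lebesgue; μ₂; opx; opx-isSup; coverSum-box)
  open Escape R
  open Interleave
  open Measure R
  open Rademacher R

  -- The difference quotient is at least 1; multiplying by the positive `d` gives a difference of
  -- values of at least `d`, and `g` ≤ `d`.
  expanding-gap : ∀ {A B : Pred ℝ 0ℓ} (f : Func (subsetoid A) (subsetoid B)) → Expanding {A} {B} f →
    ∀ a₀ a₁ {g} → 0# < g → proj₁ a₁ + g ≤ proj₁ a₀ → proj₁ (Func.to f a₁) + g ≤ proj₁ (Func.to f a₀)
  expanding-gap f expanding a₀@(x₀ , _) a₁@(x₁ , _) {g} 0<g x₁+g≤x₀ =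
    0≤-⇒≤ (diff-nonneg g≤u-v) (solve 3 (λ u v g → u :- v :- g := u :- (v :+ g)) ≈-refl u v g)
    where
    u = proj₁ (Func.to f a₀)
    v = proj₁ (Func.to f a₁)
    d = x₀ - x₁
    g≤d : g ≤ d
    g≤d = 0≤-⇒≤ (diff-nonneg x₁+g≤x₀) (solve 3 (λ x₀ x₁ g → x₀ :- (x₁ :+ g) := x₀ :- x₁ :- g) ≈-refl x₀ x₁ g)
    0<d : 0# < d
    0<d = <-≤-trans 0<g g≤d
    g≤u-v : g ≤ u - v
    g≤u-v = begin
      g                     ≤⟨ g≤d ⟩
      d                     ≈⟨ *-identityˡ d ⟨
      1# * d                ≤⟨ *-monoˡ-≤ (inj₁ 0<d) (expanding a₀ a₁ (0<-⇒< 0<d ≈-refl)) ⟩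
      (u - v) * d ⁻¹ * d    ≈⟨ solve 3 (λ u i d → u :* i :* d := u :* (d :* i)) ≈-refl (u - v) (d ⁻¹) d ⟩
      (u - v) * (d * d ⁻¹)  ≈⟨ *-congˡ (⁻¹-inverseʳ (<⇒≉0 0<d)) ⟩
      (u - v) * 1#          ≈⟨ ≈-trans (*-comm _ _) (*-identityˡ _) ⟩
      u - v                 ∎

  2^·halved-self : ∀ k x → (2 ℕ.^ k) · halved k x ≈ x
  2^·halved-self k x = ≡.subst (λ l → (2 ℕ.^ k) · halved l x ≈ x) (ℕ.+-identityʳ k) (2^·halved k 0 x)

  module _ {P : Subset} {p q e : ℝ} (0<e : 0# < e)
           (corner : ∀ {a b} → 0# ≤ a → a ≤ e → 0# ≤ b → b ≤ e → (p - a , q - b) ∈ P) where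

    module _ {h δ : ℝ} (0<h : 0# < h) (0<δ : 0# < δ) (K t : ℕ) (Kh≤e : K · h ≤ e) (tδ≤e : t · δ ≤ e) where
      open Digits h δ 0<h 0<δ

      -- A grid of `K` columns and `t` rows fits into the square of side `e` with upper right corner
      -- (p, q). Expanding maps keep its gaps, so `sparse` applies to the image. The grid runs
      -- leftwards and downwards from (p, q) to match the descending order in `Spaced`.
      contains⇒count : ∀ m → S m Contains P → t ℕ.* 2 ℕ.^ K ℕ.≤ 2 ℕ.^ m
      contains⇒count m (f , g , f-expanding , g-expanding , fg∈S) =
        ≡.subst₂ (λ t K → t ℕ.* 2 ℕ.^ K ℕ.≤ 2 ℕ.^ m) (length-tabulate z) (length-tabulate u)
          (sparse m (tabulate u) (tabulate z) us-spaced zs-spaced range rect)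
        where
        step-nonneg : ∀ {n d} → 0# < d → (i : Fin n) → 0# ≤ toℕ i · d
        step-nonneg 0<d i = ·-nonneg (toℕ i) (inj₁ 0<d)

        step≤e : ∀ {n d} → 0# < d → n · d ≤ e → (i : Fin n) → toℕ i · d ≤ e
        step≤e 0<d nd≤e i = ≤-trans (·-monoˡ-≤ (inj₁ 0<d) (ℕ.<⇒≤ (Fin.toℕ<n i))) nd≤e

        x : Fin K → ℝ
        x i = p - toℕ i · h

        y : Fin t → ℝ
        y j = q - toℕ j · δ

        grid : ∀ i j → (x i , y j) ∈ P
        grid i j = corner (step-nonneg 0<h i) (step≤e 0<h Kh≤e i) (step-nonneg 0<δ j) (step≤e 0<δ tδ≤e j)

        x∈ : ∀ i → x i ∈ xCoords P
        x∈ i = q - 0# , corner (step-nonneg 0<h i) (step≤e 0<h Kh≤e i) ≤-refl (inj₁ 0<e)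

        y∈ : ∀ j → y j ∈ yCoords P
        y∈ j = p - 0# , corner ≤-refl (inj₁ 0<e) (step-nonneg 0<δ j) (step≤e 0<δ tδ≤e j)

        u : Fin K → ℝ
        u i = proj₁ (Func.to f (x i , x∈ i))

        z : Fin t → ℝ
        z j = proj₁ (Func.to g (y j , y∈ j))

        gap : ∀ {c d i j} → 0# < d → i ℕ.< j → (c - j · d) + d ≤ c - i · d
        gap {c} {d} {i} {j} 0<d i<j = 0≤-⇒≤ (diff-nonneg (·-monoˡ-≤ (inj₁ 0<d) i<j))
          (solve 4 (λ c d id jd → jd :- (d :+ id) := c :- id :- (c :- jd :+ d)) ≈-refl c d (i · d) (j · d))

        us-spaced : Spaced h (tabulate u)
        us-spaced = AllPairs.tabulate⁺-< λ {i} {j} i<j →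
          expanding-gap f f-expanding (x i , x∈ i) (x j , x∈ j) 0<h (gap 0<h i<j)

        zs-spaced : Spaced δ (tabulate z)
        zs-spaced = AllPairs.tabulate⁺-< λ {i} {j} i<j →
          expanding-gap g g-expanding (y i , y∈ i) (y j , y∈ j) 0<δ (gap 0<δ i<j)

        range : ∀ {c} → c ∈ˡ tabulate z → 0# ≤ c × c < w m
        range c∈ with ∈-tabulate⁻ c∈
        ... | j , ≡.refl = let _ , p∈S = proj₂ (Func.to g (y j , y∈ j))
                               _ , 0<z , z<w = S-bounds m p∈S in inj₁ 0<z , z<w

        rect : ∀ {a c} → a ∈ˡ tabulate u → c ∈ˡ tabulate z → (a , c) ∈ S m
        rect a∈ c∈ with ∈-tabulate⁻ a∈ | ∈-tabulate⁻ c∈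
        ... | i , ≡.refl | j , ≡.refl =
          -- `fg∈S` evaluates `f` and `g` at membership proofs taken from the grid point, `u` and
          -- `z` at other ones; congruence identifies the values.
          S-resp-≈ m (Func.cong f ≈-refl) (Func.cong g ≈-refl) (fg∈S (grid i j))

    module _ {n : ℝ} (0<n : 0# < n) (k : ℕ) (small : halved k n ≤ e) where
      n⁺ : ℝ⁺
      n⁺ = n , 0<n

      -- K = 2^k points at distance h = n/M fit into a side of length e, so M is
      -- a multiple of K; the t = 2^(M-k) points at distance δ = n/2^M fit as
      -- well, and t 2^K > 2^M because K > k.
      M : ℕ
      M = 2 ℕ.^ (k ℕ.+ k)

      h δ : ℝ
      h = halved (k ℕ.+ k) n
      δ = halved M n

      0<h : 0# < h
      0<h = halved-pos (k ℕ.+ k) 0<n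

      0<δ : 0# < δ
      0<δ = halved-pos M 0<n

      open Digits h δ 0<h 0<δ

      Mh≈n : M · h ≈ n
      Mh≈n = 2^·halved-self (k ℕ.+ k) n

      wM≈n : w M ≈ n
      wM≈n = 2^·halved-self M n

      k≤M : k ℕ.≤ M
      k≤M = ℕ.≤-trans (ℕ.m≤m+n k k) (ℕ.<⇒≤ (k<2^k (k ℕ.+ k)))

      S-free : S M IsFreeOf P
      S-free contains = ℕ.<⇒≱ too-many (contains⇒count 0<h 0<δ (2 ℕ.^ k) (2 ℕ.^ (M ℕ.∸ k)) Kh≤e tδ≤e M contains)
        where
        Kh≤e : (2 ℕ.^ k) · h ≤ e
        Kh≤e = ≤-trans (inj₂ (2^·halved k k n)) small

        tδ≤e : (2 ℕ.^ (M ℕ.∸ k)) · δ ≤ e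
        tδ≤e = ≤-trans (inj₂ (≡.subst (λ l → (2 ℕ.^ (M ℕ.∸ k)) · halved l n ≈ halved k n)
          (ℕ.m∸n+n≡m k≤M) (2^·halved (M ℕ.∸ k) k n))) small

        too-many : 2 ℕ.^ M ℕ.< 2 ℕ.^ (M ℕ.∸ k) ℕ.* 2 ℕ.^ (2 ℕ.^ k)
        too-many = ≡.subst (2 ℕ.^ M ℕ.<_) (ℕ.^-distribˡ-+-* 2 (M ℕ.∸ k) (2 ℕ.^ k))
          (ℕ.^-monoʳ-< 2 (ℕ.s≤s (ℕ.s≤s ℕ.z≤n))
            (≡.subst (ℕ._< M ℕ.∸ k ℕ.+ 2 ℕ.^ k) (ℕ.m∸n+n≡m k≤M) (ℕ.+-monoʳ-< (M ℕ.∸ k) (k<2^k k))))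

      S⊆□ : S M ⊆ Box.points (square n⁺)
      S⊆□ p∈S = let (0<x , x<) , (0<y , y<) = S-bounds M p∈S in
        (inj₁ 0<x , inj₁ (<-respʳ-≈ Mh≈n x<)) , (inj₁ 0<y , inj₁ (<-respʳ-≈ wM≈n y<))

      0≤n : 0# ≤ n
      0≤n = inj₁ 0<n

      -- The segments that the set and its mirror image may miss. They are indexed by all naturals
      -- to form a sequence; those with large index lie outside the square.
      vertical horizontal : ℕ → Rect
      vertical   i = interval {i · h} ≤-refl , interval 0≤n
      horizontal j = interval 0≤n , interval {j · δ} ≤-refl

      S-cover : ∀ {x y} → (x , y) ∈ᴿ (interval 0≤n , interval 0≤n) →
        (∀ k → ¬ ((x , y) ∈ᴿ interleave vertical horizontal k)) → (x , y) ∈ S M ⊎ (x , n - y) ∈ S M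
      S-cover {x} {y} (x∈@(0≤x , x≤n) , y∈@(0≤y , y≤n)) ∉line
        with mirror-cover M 0≤x (≤-trans x≤n (inj₂ (≈-sym Mh≈n))) 0≤y (≤-trans y≤n (inj₂ (≈-sym wM≈n)))
               (λ i x≈ → interleave-∀ˡ (λ Q → ¬ ((x , y) ∈ᴿ Q)) {vertical} {horizontal} ∉line i ((inj₂ (≈-sym x≈) , inj₂ x≈) , y∈))
               (λ j y≈ → interleave-∀ʳ (λ Q → ¬ ((x , y) ∈ᴿ Q)) {vertical} {horizontal} ∉line j (x∈ , (inj₂ (≈-sym y≈) , inj₂ y≈)))
      ... | inj₁ p∈S = inj₁ p∈S
      ... | inj₂ p∈S = inj₂ (S-resp-≈ M ≈-refl (+-congʳ wM≈n) p∈S)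

      ½n²≤μ₂ : ½ * (n * n) ≤ μ₂ (S M) (square n⁺ , S⊆□)
      ½n²≤μ₂ = proj₂ (proj₂ (lebesgue (S M) (square n⁺ , S⊆□)))
        (half-area≤cover (S M) 0≤n (interleave vertical horizontal)
          (interleave-∀ Degenerate (λ i → inj₁ (inj₂ (-‿inverseʳ _))) (λ j → inj₂ (inj₂ (-‿inverseʳ _))))
          S-cover)

      ½n²≤opx : (P-nonempty : Satisfiable P) → ½ * (n * n) ≤ opx n⁺ P P-nonempty
      ½n²≤opx P-nonempty = ≤-trans ½n²≤μ₂
        (proj₁ (proj₂ (opx-isSup n⁺ P P-nonempty)) (S M , S-open M , S-free , S⊆□ , ≈-refl))

  -- The square is itself a cover by one box, so n² bounds the measure of every competing set.
  opx≤n² : ∀ (n : ℝ⁺) P P-nonempty → opx n P P-nonempty ≤ 1# * (proj₁ n * proj₁ n)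
  opx≤n² n⁺@(n , _) P P-nonempty = proj₂ (proj₂ (opx-isSup n⁺ P P-nonempty)) λ (S , _ , _ , S⊆□ , m≈) →
    ≤-trans (inj₂ m≈) (≤-trans (proj₁ (proj₂ (lebesgue S (square n⁺ , S⊆□))) (coverSum-box S (square n⁺) S⊆□))
      (inj₂ (≈-trans (square-area n) (≈-sym (*-identityˡ (n * n))))))
    where
    square-area : ∀ n → (n - 0#) * (n - 0#) ≈ n * n
    square-area = solve 1 (λ n → (n :- con (+ 0)) :* (n :- con (+ 0)) := n :* n) ≈-refl

  -- Half the radius r of a ball about (p, q) serves as `e`: a² + b² ≤ 2e² < 4e² = r².
  open-corner : ∀ {P} → IsOpen P → ∀ {p q} → (p , q) ∈ P →
    ∃[ e ] 0# < e × (∀ {a b} → 0# ≤ a → a ≤ e → 0# ≤ b → b ≤ e → (p - a , q - b) ∈ P)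
  open-corner openP {p} {q} pq∈P =
    let r , 0<r , ball = openP pq∈P
        e = ½ * r
        0<e = *-pos 0<½ 0<r
    in e , 0<e , λ {a} {b} 0≤a a≤e 0≤b b≤e → ball (begin-strict
      (p - a - p) * (p - a - p) + (q - b - q) * (q - b - q)  ≈⟨ distance p q a b ⟩
      a * a + b * b                                  ≤⟨ +-mono-≤ (*-mono-≤ 0≤a (inj₁ 0<e) a≤e a≤e) (*-mono-≤ 0≤b (inj₁ 0<e) b≤e b≤e) ⟩
      e * e + e * e                                  ≈⟨ +-identityʳ _ ⟨
      e * e + e * e + 0#                             <⟨ +-monoʳ-< _ (+-pos (*-pos 0<e 0<e) (inj₁ (*-pos 0<e 0<e))) ⟩
      e * e + e * e + (e * e + e * e)                ≈⟨ double e ⟩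
      (e + e) * (e + e)                              ≈⟨ *-cong (½+½ r) (½+½ r) ⟩
      r * r                                          ∎)
    where
    distance : ∀ p q a b → (p - a - p) * (p - a - p) + (q - b - q) * (q - b - q) ≈ a * a + b * b
    distance = solve 4 (λ p q a b → (p :- a :- p) :* (p :- a :- p) :+ (q :- b :- q) :* (q :- b :- q) := a :* a :+ b :* b) ≈-refl
    double : ∀ e → e * e + e * e + (e * e + e * e) ≈ (e + e) * (e + e)
    double = solve 1 (λ e → e :* e :+ e :* e :+ (e :* e :+ e :* e) := (e :+ e) :* (e :+ e)) ≈-refl

theorem4p4 : (R : CompleteOrderedField) → let open Plane R in
    ∃[ C₂ ] (∀ (P : Subset) (P-nonempty : Satisfiable P) → IsOpen P →
    ∃[ C₁ ] (λ n → opx n P P-nonempty) =Θ[ C₁ , C₂ ] (λ (n , _) → n * n))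
-- A k with n/2^k ≤ e is only shown not to be impossible; this suffices, as the
-- order is decidable and ≤ may be proved by contradiction.
theorem4p4 R = 1# , λ P P-nonempty openP → ½ , 0<½ , 0<1 , 0# , λ n _ →
  let e , 0<e , corner = open-corner openP (proj₂ P-nonempty) in
  ≮⇒≥ (λ opx<½n² → halved-small 0<e λ k → ≮⇒≥ λ small →
    <⇒≱ opx<½n² (½n²≤opx 0<e corner (proj₂ n) k (inj₁ small) P-nonempty)) ,
  opx≤n² n P P-nonempty
  where
  open OrderedField R
  open Escape R
  open Final R
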